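{- Let $\Gamma=(S,R)$ be a finite simple connected graph which is nondegenerate but is not the line graph of any simple graph. Let $H$ be the subgroup of ${\rm GL}(V^\ast)$ generated by the maps $\kappa_s$ ($s\in S$). Then $H$ is isomorphic to the orthogonal group $O(V)=\{\sigma\in {\rm GL}(V)\mid Q(\sigma\alpha)=Q(\alpha)\ \text{for all }\alpha\in V\}$. Moreover, the $H$-orbits on $V^\ast$ are exactly $$\{0\},\qquad \theta\big(Q^{ -1}(0)\setminus\{0\}\big),\qquad \theta\big(Q^{ -1}(1)\big).$$
   Context: Let $\mathbb{F}_2=\{0,1\}$. Let $V$ be the $\mathbb{F}_2$-vector space with basis $\{\alpha_s\mid s\in S\}$, and let $V^\ast$ be its dual space with dual basis $\{f_s\mid s\in S\}$, so $f_s(\alpha_t)=1$ if $s=t$ and $0$ otherwise. Let $B$ be the bilinear form on $V$ with $B(\alpha_s,\alpha_t)=1$ if $st\in R$ and $0$ otherwise. The graph $\Gamma$ is called nondegenerate if $B$ is nondegenerate, i.e. the only $\alpha\in V$ with $B(\alpha,\beta)=0$ for all $\beta\in V$ is $\alpha=0$. Equivalently, the adjacency matrix of $\Gamma$ over $\mathbb{F}_2$ is invertible. Define $\theta:V\to V^\ast$ by $\theta(\alpha)(\beta)=B(\alpha,\beta)$. For $s\in S$, define $\kappa_s:V^\ast\to V^\ast$ by $\kappa_s f=f+f(\alpha_s)\sum_{st\in R}f_t$. This is the move of the lit-only $\sigma$-game at vertex $s$, where a configuration $f$ has vertex $t$ "on" iff $f(\alpha_t)=1$. Let $Q:V\to\mathbb{F}_2$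 be the unique quadratic form satisfying $Q(\alpha+\beta)=Q(\alpha)+Q(\beta)+B(\alpha,\beta)$ for all $\alpha,\beta\in V$ and $Q(\alpha_s)=1$ for all $s\in S$. The line graph of a graph $G$ has the edges of $G$ as vertices, with two of them adjacent iff they share an endpoint. -}

module Defs where

open import Data.Nat using (ℕ; zero; suc)
open import Data.Bool using (Bool; true; false; _∧_; _xor_; if_then_else_)
open import Data.Fin using (Fin; zero; suc; _<_; _≟_)
open import Data.Vec using (Vec; lookup; tabulate; zipWith; replicate)
open import Data.List using (List; []; _∷_; foldr)
open import Data.Product using (Σ; ∃; ∃-syntax; _×_; _,_; proj₁; proj₂)
open import Data.Sum using (_⊎_)
open import Function using (id; _∘_)
open import Relation.Nullary using (¬_)
open import Relation.Nullary.Decidable using (⌊_⌋)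
open import Relation.Binary.PropositionalEquality using (_≡_; _≢_; _≗_)

record Graph (n : ℕ) : Set where
  field
    adj     : Fin n → Fin n → Bool
    adj-sym : ∀ s t → adj s t ≡ adj t s
    irrefl  : ∀ s → adj s s ≡ false
open Graph public

data Walk {n : ℕ} (Γ : Graph n) : Fin n → Fin n → Set where
  here : ∀ {s} → Walk Γ s s
  step : ∀ {s u t} → adj Γ s u ≡ true → Walk Γ u t → Walk Γ s t

Connected : ∀ {n} → Graph n → Set
Connected Γ = ∀ s t → Walk Γ s t

-- Γ is (isomorphic to) the line graph of some (finite) simple graph G:
-- a bijection e between the vertices of Γ and the edges {a,b} (a < b) of G
-- such that s,t are adjacent in Γ iff s ≠ t and e s, e t share an endpoint.
ShareEndpoint : ∀ {m} → Fin m × Fin m → Fin m × Fin m → Set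
ShareEndpoint (a , b) (c , d) = (a ≡ c) ⊎ (a ≡ d) ⊎ (b ≡ c) ⊎ (b ≡ d)

IsLineGraph : ∀ {n} → Graph n → Set
IsLineGraph {n} Γ =
  Σ ℕ λ m → Σ (Graph m) λ G → Σ (Fin n → Fin m × Fin m) λ e →
    (∀ s → (proj₁ (e s) < proj₂ (e s)) × (adj G (proj₁ (e s)) (proj₂ (e s)) ≡ true)) ×
    (∀ s t → e s ≡ e t → s ≡ t) ×
    (∀ a b → a < b → adj G a b ≡ true → ∃[ s ] e s ≡ (a , b)) ×
    (∀ s t → (adj Γ s t ≡ true → (s ≢ t × ShareEndpoint (e s) (e t)))
           × ((s ≢ t × ShareEndpoint (e s) (e t)) → adj Γ s t ≡ true))

-- Linear algebra over F₂ = Bool (xor = +, ∧ = ·)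

⊕ : ∀ {n} → (Fin n → Bool) → Bool
⊕ {zero}  f = false
⊕ {suc n} f = f zero xor ⊕ (f ∘ suc)

-- V and V* are both F₂^n, in coordinates w.r.t. {α_s} resp. {f_s}.
V : ℕ → Set
V n = Vec Bool n

V* : ℕ → Set
V* n = Vec Bool n

0V : ∀ {n} → Vec Bool n
0V = replicate _ false

_+V_ : ∀ {n} → Vec Bool n → Vec Bool n → Vec Bool n
_+V_ = zipWith _xor_

basis : ∀ {n} → Fin n → V n
basis s = tabulate λ t → ⌊ t ≟ s ⌋

B : ∀ {n} → Graph n → V n → V n → Bool
B Γ α β = ⊕ λ s → ⊕ λ t → lookup α s ∧ lookup β t ∧ adj Γ s t

NonDegenerate : ∀ {n} → Graph n → Set
NonDegenerate {n} Γ = ∀ (α : V n) → (∀ β → B Γ α β ≡ false) → α ≡ 0V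

θ : ∀ {n} → Graph n → V n → V* n
θ Γ α = tabulate λ t → B Γ α (basis t)

-- κ_s f = f + f(α_s) Σ_{st ∈ R} f_t
κ : ∀ {n} → Graph n → Fin n → V* n → V* n
κ Γ s f = f +V (if lookup f s then tabulate (adj Γ s) else 0V)

-- The quadratic form Q, written out explicitly:
-- Q(α) = Σ_s α_s + Σ_{s<t} α_s α_t B(α_s,α_t).
-- It is the unique form with Q(α+β)=Q(α)+Q(β)+B(α,β), Q(α_s)=1.
Q : ∀ {n} → Graph n → V n → Bool
Q Γ α = (⊕ λ s → lookup α s)
   xor (⊕ λ s → ⊕ λ t → ⌊ s Data.Fin.<? t ⌋ ∧ lookup α s ∧ lookup α t ∧ adj Γ s t)

-- The group H = ⟨κ_s⟩ ≤ GL(V*): elements are represented by words in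
-- the generators, acting by composition; two words are the same element
-- of H iff they act identically on V*.

act : ∀ {n} → Graph n → List (Fin n) → V* n → V* n
act Γ = foldr (λ s h → κ Γ s ∘ h) id

Linear : ∀ {n} → (V n → V n) → Set
Linear σ = ∀ α β → σ (α +V β) ≡ σ α +V σ β

InGL : ∀ {n} → (V n → V n) → Set
InGL {n} σ = Linear σ × Σ (V n → V n) λ τ → (τ ∘ σ ≗ id) × (σ ∘ τ ≗ id)

InO : ∀ {n} → Graph n → (V n → V n) → Set
InO Γ σ = InGL σ × (∀ α → Q Γ (σ α) ≡ Q Γ α)

HIsoO : ∀ {n} → Graph n → Set
HIsoO {n} Γ =
  Σ (List (Fin n) → V n → V n) λ Φ →
    (∀ w → InO Γ (Φ w)) ×
    (∀ w w' → (act Γ w ≗ act Γ w' → Φ w ≗ Φ w') × (Φ w ≗ Φ w' → act Γ w ≗ act Γ w')) ×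
    (∀ w w' → Φ (w Data.List.++ w') ≗ Φ w ∘ Φ w') ×
    (∀ σ → InO Γ σ → ∃[ w ] Φ w ≗ σ)

InOrbit : ∀ {n} → Graph n → V* n → V* n → Set
InOrbit Γ f g = ∃[ w ] act Γ w f ≡ g

X₀ : ∀ {n} → Graph n → V* n → Set
X₀ Γ f = f ≡ 0V

X₁ : ∀ {n} → Graph n → V* n → Set
X₁ Γ f = ∃[ α ] (Q Γ α ≡ false × α ≢ 0V × θ Γ α ≡ f)

X₂ : ∀ {n} → Graph n → V* n → Set
X₂ Γ f = ∃[ α ] (Q Γ α ≡ true × θ Γ α ≡ f)

OrbitIs : ∀ {n} → Graph n → V* n → (V* n → Set) → Set
OrbitIs Γ f X = ∀ g → (InOrbit Γ f g → X g) × (X g → InOrbit Γ f g)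

OrbitsAre : ∀ {n} → Graph n → Set
OrbitsAre Γ =
  (∀ f → OrbitIs Γ f (X₀ Γ) ⊎ OrbitIs Γ f (X₁ Γ) ⊎ OrbitIs Γ f (X₂ Γ)) ×
  (∃[ f ] OrbitIs Γ f (X₀ Γ)) × (∃[ f ] OrbitIs Γ f (X₁ Γ)) × (∃[ f ] OrbitIs Γ f (X₂ Γ))

{-# OPTIONS --safe #-}
module Submission where

-- θ carries κ_s to the transvection t_s x = x + B(x,α_s) α_s, so H acts on V as G = ⟨t_s⟩ ≤ O(V).
-- Call v with Q(v) = 1 a root if t_v ∈ G; the sum of two non-orthogonal roots is again a root.
--
-- Start from a family of points whose pairwise sums are roots, and enlarge it as long as possible.
-- A vertex α_s colours the points by B(α_s,·); a colour used once yields a new point, and two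
-- colours used three times each yield roots forming an E₆ diagram. When neither happens, every
-- vertex is orthogonal to all sums of points or agrees with one such sum against all of them; by
-- nondegeneracy and connectedness either the family still grows, or every vertex is a sum of two
-- points, which presents Γ as a line graph. So Γ has six roots forming an E₆ diagram.
--
-- They span a nondegenerate U, and V = U ⊕ U^⊥. Playing a coset of U against the roots of U shows,
-- along walks in Γ and then for all sums, that every v with Q(v) = 1 is a root. With all
-- reflections available, the room in U moves any nonzero vector to a fixed one with the same Q,
-- and lets reflections undo a given isometry on spanning vectors of U^⊥ one by one; on U itself
-- what remains is a finite check in O₆⁻(2).

open import Defs
open import Data.Nat as ℕ using (ℕ; zero; suc; _^_; _+_)
import Data.Nat.Properties as ℕ
open import Data.Bool using (Bool; true; false; not; _∧_; _xor_; if_then_else_)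
open import Data.Bool.Properties as Bool using (¬-not; xor-assoc; xor-comm; xor-identityˡ; xor-identityʳ; xor-same)
open import Data.Fin using (Fin; zero; suc; toℕ; inject₁; combine; _<_; _<?_; _≟_)
open import Data.Fin.Patterns
open import Data.Fin.Properties using (any?; all?; <-cmp; <-irrefl; <-asym; combine-injective; pigeonhole)
open import Data.Fin.Subset.Properties using (anySubset?)
open import Data.List as List using (List; []; _∷_; [_]; _++_; _ʳ++_; foldr; map; reverse)
open import Data.List.Properties using (unfold-reverse)
open import Data.List.Relation.Unary.All as All using (All; []; _∷_)
import Data.List.Relation.Unary.All.Properties as All
open import Data.Maybe as Maybe using (Maybe; just; nothing; _<∣>_; Is-just; to-witness)
import Data.Maybe.Relation.Unary.Any as MaybeAny
open import Data.Product using (∃-syntax; ∃₂; _×_; _,_; proj₁; proj₂; map₂)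
import Data.Product.Properties as Prod
open import Data.Sum using (_⊎_; inj₁; inj₂; [_,_]′; swap)
open import Data.Unit using (⊤; tt)
open import Data.Vec using (Vec; []; _∷_; lookup; tabulate)
open import Data.Vec.Properties using (≡-dec; zipWith-assoc; zipWith-comm; zipWith-identityˡ; zipWith-identityʳ; lookup-zipWith; lookup-replicate; lookup∘tabulate; tabulate∘lookup; tabulate-cong)
open import Data.Vec.Relation.Unary.All using ([]; _∷_)
open import Data.Vec.Relation.Unary.AllPairs using ([]; _∷_)
open import Data.Vec.Relation.Unary.Unique.Propositional using (Unique)
open import Data.Vec.Relation.Unary.Unique.Propositional.Properties using (lookup-injective)
open import Function using (_∘_; id; mk⇔)
open import Relation.Binary using (tri<; tri≈; tri>)
open import Relation.Binary.PropositionalEquality using (_≡_; _≢_; _≗_; refl; sym; trans; cong; cong₂; subst; module ≡-Reasoning)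
open import Relation.Nullary using (Dec; yes; no; ¬_; ¬?; contradiction)
open import Relation.Nullary.Decidable using (⌊_⌋; _×-dec_; _⊎-dec_; _→-dec_; map′; from-yes; isYes≗does; dec-true; dec-false; decidable-stable)

-- Boolean identities, checked by truth table

BoolFun : ℕ → Set
BoolFun zero    = Bool
BoolFun (suc k) = Bool → BoolFun k

agree : ∀ k → BoolFun k → BoolFun k → Bool
agree zero    f g = not (f xor g)
agree (suc k) f g = agree k (f true) (g true) ∧ agree k (f false) (g false)

Agree : ∀ k → BoolFun k → BoolFun k → Set
Agree zero    f g = f ≡ g
Agree (suc k) f g = ∀ x → Agree k (f x) (g x)

∧-trueˡ : ∀ {x y} → x ∧ y ≡ true → x ≡ true
∧-trueˡ {true} _ = refl

∧-trueʳ : ∀ {x y} → x ∧ y ≡ true → y ≡ true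
∧-trueʳ {true} e = e

truth-table : ∀ k f g → agree k f g ≡ true → Agree k f g
truth-table zero    true  true  _ = refl
truth-table zero    false false _ = refl
truth-table (suc k) f g e true  = truth-table k _ _ (∧-trueˡ e)
truth-table (suc k) f g e false = truth-table k _ _ (∧-trueʳ {agree k (f true) (g true)} e)

true≢false : ∀ {x} → x ≡ true → x ≢ false
true≢false refl ()

xor-true⇒not : ∀ {x y} → x xor y ≡ true → x ≡ not y
xor-true⇒not {true}  {false} _ = refl
xor-true⇒not {false} {true}  _ = refl

-- Vectors over F₂

+V-comm : ∀ {n} (x y : V n) → x +V y ≡ y +V x
+V-comm = zipWith-comm xor-comm

+V-assoc : ∀ {n} (x y z : V n) → (x +V y) +V z ≡ x +V (y +V z)
+V-assoc = zipWith-assoc xor-assoc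

+V-identityˡ : ∀ {n} (x : V n) → 0V +V x ≡ x
+V-identityˡ = zipWith-identityˡ xor-identityˡ

+V-identityʳ : ∀ {n} (x : V n) → x +V 0V ≡ x
+V-identityʳ = zipWith-identityʳ xor-identityʳ

+V-self : ∀ {n} (x : V n) → x +V x ≡ 0V
+V-self []      = refl
+V-self (b ∷ x) = cong₂ _∷_ (xor-same b) (+V-self x)

infixr 7 _·_

_·_ : ∀ {n} → Bool → V n → V n
c · x = if c then x else 0V

·-distrib-xor : ∀ {n} c d (x : V n) → (c xor d) · x ≡ (c · x) +V (d · x)
·-distrib-xor true  true  x = sym (+V-self x)
·-distrib-xor true  false x = sym (+V-identityʳ x)
·-distrib-xor false d     x = sym (+V-identityˡ _)

+V-interchange : ∀ {n} (x y z w : V n) → (x +V y) +V (z +V w) ≡ (x +V z) +V (y +V w)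
+V-interchange x y z w = begin
  (x +V y) +V (z +V w)  ≡⟨ +V-assoc x y _ ⟩
  x +V (y +V (z +V w))  ≡⟨ cong (x +V_) (sym (+V-assoc y z w)) ⟩
  x +V ((y +V z) +V w)  ≡⟨ cong (λ t → x +V (t +V w)) (+V-comm y z) ⟩
  x +V ((z +V y) +V w)  ≡⟨ cong (x +V_) (+V-assoc z y w) ⟩
  x +V (z +V (y +V w))  ≡⟨ sym (+V-assoc x z _) ⟩
  (x +V z) +V (y +V w)  ∎
  where open ≡-Reasoning

lin : ∀ {k n} → V k → Vec (V n) k → V n
lin []      []       = 0V
lin (c ∷ u) (e ∷ es) = (c · e) +V lin u es

lin-0 : ∀ {k n} (es : Vec (V n) k) → lin 0V es ≡ 0V
lin-0 []       = refl
lin-0 (e ∷ es) = trans (+V-identityˡ _) (lin-0 es)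

lin-+ : ∀ {k n} (u v : V k) (es : Vec (V n) k) → lin (u +V v) es ≡ lin u es +V lin v es
lin-+ []      []      []       = sym (+V-identityˡ _)
lin-+ (c ∷ u) (d ∷ v) (e ∷ es) =
  trans (cong₂ _+V_ (·-distrib-xor c d e) (lin-+ u v es)) (+V-interchange (c · e) (d · e) _ _)

basis-suc : ∀ {k} (s : Fin k) → basis (suc s) ≡ false ∷ basis s
basis-suc s = cong (false ∷_) (tabulate-cong λ t → trans (isYes≗does (suc t ≟ suc s)) (sym (isYes≗does (t ≟ s))))

tabulate-false : ∀ {k} → tabulate {n = k} (λ _ → false) ≡ 0V
tabulate-false {zero}  = refl
tabulate-false {suc k} = cong (false ∷_) tabulate-false

basis-zero : ∀ {k} → basis {suc k} zero ≡ true ∷ 0V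
basis-zero = cong (true ∷_) tabulate-false

lin-basis : ∀ {k n} (s : Fin k) (es : Vec (V n) k) → lin (basis s) es ≡ lookup es s
lin-basis zero    (e ∷ es) = trans (cong (λ u → lin u (e ∷ es)) basis-zero)
                                   (trans (cong (e +V_) (lin-0 es)) (+V-identityʳ e))
lin-basis (suc s) (e ∷ es) = trans (cong (λ u → lin u (e ∷ es)) (basis-suc s))
                                   (trans (+V-identityˡ _) (lin-basis s es))

basis-induction : ∀ {n} (P : V n → Set) → P 0V → (∀ x y → P x → P y → P (x +V y)) →
                  (∀ s → P (basis s)) → ∀ x → P x
basis-induction {zero}  P P0 P+ Pb []      = P0
basis-induction {suc n} P P0 P+ Pb (b ∷ x) = subst P (cong₂ _∷_ (xor-identityʳ b) (+V-identityˡ x))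
    (P+ (b ∷ 0V) (false ∷ x) (head b)
        (basis-induction (P ∘ (false ∷_)) P0 (λ y z → P+ (false ∷ y) (false ∷ z))
                         (λ s → subst P (basis-suc s) (Pb (suc s))) x))
  where
  head : ∀ b → P (b ∷ 0V)
  head true  = subst P basis-zero (Pb zero)
  head false = P0

basis-injective : ∀ {n} (s t : Fin n) → basis s ≡ basis t → s ≡ t
basis-injective s t e with s ≟ t
... | yes s≡t = s≡t
... | no  s≢t = contradiction {A = true ≡ false} (begin
  true               ≡⟨ sym (trans (isYes≗does (s ≟ s)) (dec-true (s ≟ s) refl)) ⟩
  ⌊ s ≟ s ⌋          ≡⟨ sym (lookup∘tabulate _ s) ⟩
  lookup (basis s) s ≡⟨ cong (λ v → lookup v s) e ⟩
  lookup (basis t) s ≡⟨ lookup∘tabulate _ s ⟩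
  ⌊ s ≟ t ⌋          ≡⟨ trans (isYes≗does (s ≟ t)) (dec-false (s ≟ t) s≢t) ⟩
  false              ∎) λ ()
  where open ≡-Reasoning

-- Vector identities, checked by comparing coefficients

infixl 6 _⊞_

data Expr (k : ℕ) : Set where
  var : Fin k → Expr k
  _⊞_ : Expr k → Expr k → Expr k
  ∅   : Expr k

coeffs : ∀ {k} → Expr k → V k
coeffs (var i) = basis i
coeffs (e ⊞ f) = coeffs e +V coeffs f
coeffs ∅       = 0V

⟦_⟧ : ∀ {k n} → Expr k → Vec (V n) k → V n
⟦ var i ⟧ ρ = lookup ρ i
⟦ e ⊞ f ⟧ ρ = ⟦ e ⟧ ρ +V ⟦ f ⟧ ρ
⟦ ∅     ⟧ ρ = 0V

⟦⟧≡lin : ∀ {k n} (e : Expr k) (ρ : Vec (V n) k) → ⟦ e ⟧ ρ ≡ lin (coeffs e) ρ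
⟦⟧≡lin (var i) ρ = sym (lin-basis i ρ)
⟦⟧≡lin (e ⊞ f) ρ = trans (cong₂ _+V_ (⟦⟧≡lin e ρ) (⟦⟧≡lin f ρ)) (sym (lin-+ (coeffs e) (coeffs f) ρ))
⟦⟧≡lin ∅       ρ = sym (lin-0 ρ)

vsolve : ∀ {k n} (e f : Expr k) → coeffs e ≡ coeffs f → (ρ : Vec (V n) k) → ⟦ e ⟧ ρ ≡ ⟦ f ⟧ ρ
vsolve e f eq ρ = trans (⟦⟧≡lin e ρ) (trans (cong (λ u → lin u ρ) eq) (sym (⟦⟧≡lin f ρ)))

pattern #0 = var zero
pattern #1 = var (suc zero)
pattern #2 = var (suc (suc zero))
pattern #3 = var (suc (suc (suc zero)))

+V-cancel : ∀ {n} (x y : V n) → x +V y ≡ 0V → x ≡ y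
+V-cancel x y e = trans (vsolve #0 ((#0 ⊞ #1) ⊞ #1) refl (x ∷ y ∷ []))
                        (trans (cong (_+V y) e) (+V-identityˡ y))

-- Sums over F₂

⊕-cong : ∀ {n} {f g : Fin n → Bool} → (∀ s → f s ≡ g s) → ⊕ f ≡ ⊕ g
⊕-cong {zero}  e = refl
⊕-cong {suc n} e = cong₂ _xor_ (e zero) (⊕-cong (e ∘ suc))

⊕-xor : ∀ {n} (f g : Fin n → Bool) → ⊕ (λ s → f s xor g s) ≡ ⊕ f xor ⊕ g
⊕-xor {zero}  f g = refl
⊕-xor {suc n} f g = trans (cong ((f zero xor g zero) xor_) (⊕-xor (f ∘ suc) (g ∘ suc)))
  (truth-table 4 (λ a b c d → (a xor b) xor (c xor d)) (λ a b c d → (a xor c) xor (b xor d)) refl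
    (f zero) (g zero) (⊕ (f ∘ suc)) (⊕ (g ∘ suc)))

⊕-false : ∀ {n} → ⊕ {n} (λ _ → false) ≡ false
⊕-false {zero}  = refl
⊕-false {suc n} = ⊕-false {n}

⊕-swap : ∀ {m n} (h : Fin m → Fin n → Bool) → ⊕ (λ s → ⊕ λ t → h s t) ≡ ⊕ (λ t → ⊕ λ s → h s t)
⊕-swap {zero}  {n} h = sym (⊕-false {n})
⊕-swap {suc m} {n} h = trans (cong (⊕ (h zero) xor_) (⊕-swap (h ∘ suc)))
  (sym (⊕-xor (h zero) (λ t → ⊕ λ s → h (suc s) t)))

∧-⊕ : ∀ {n} c (f : Fin n → Bool) → c ∧ ⊕ f ≡ ⊕ (λ s → c ∧ f s)
∧-⊕ {n} true  f = refl
∧-⊕ {n} false f = sym (⊕-false {n})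

⊕-basis : ∀ {n} (s : Fin n) (f : Fin n → Bool) → ⊕ (λ t → lookup (basis s) t ∧ f t) ≡ f s
⊕-basis {suc n} zero f = trans (⊕-cong (λ t → cong (λ v → lookup v t ∧ f t) basis-zero))
  (trans (cong (f zero xor_) (trans (⊕-cong λ t → cong (_∧ f (suc t)) (lookup-replicate t false)) (⊕-false {n})))
         (xor-identityʳ _))
⊕-basis {suc n} (suc s) f = trans (⊕-cong (λ t → cong (λ v → lookup v t ∧ f t) (basis-suc s)))
  (⊕-basis s (f ∘ suc))

-- The forms B and Q of a graph

module _ {n : ℕ} (Γ : Graph n) where

  ordered-part : (Fin n → Fin n → Bool) → Bool
  ordered-part h = ⊕ λ s → ⊕ λ t → ⌊ s <? t ⌋ ∧ h s t

  ordered-part-xor : ∀ g h → ordered-part (λ s t → g s t xor h s t) ≡ ordered-part g xor ordered-part h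
  ordered-part-xor g h = trans
    (⊕-cong λ s → trans
      (⊕-cong λ t → truth-table 3 (λ c x y → c ∧ (x xor y)) (λ c x y → (c ∧ x) xor (c ∧ y)) refl
                      ⌊ s <? t ⌋ (g s t) (h s t))
      (⊕-xor (λ t → ⌊ s <? t ⌋ ∧ g s t) _))
    (⊕-xor (λ s → ⊕ λ t → ⌊ s <? t ⌋ ∧ g s t) _)

  -- The part below the diagonal is the part above it for the transposed array. This lets `B`, a sum
  -- over all pairs, be compared with `Q`, a sum over pairs s < t.
  ⊕⊕-split : ∀ h → (∀ s → h s s ≡ false) →
             ⊕ (λ s → ⊕ λ t → h s t) ≡ ordered-part h xor ordered-part (λ s t → h t s)
  ⊕⊕-split h diag = begin
    ⊕ (λ s → ⊕ λ t → h s t)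
      ≡⟨ ⊕-cong (λ s → ⊕-cong (point s)) ⟩
    ⊕ (λ s → ⊕ λ t → (⌊ s <? t ⌋ ∧ h s t) xor (⌊ t <? s ⌋ ∧ h s t))
      ≡⟨ ⊕-cong (λ s → ⊕-xor (λ t → ⌊ s <? t ⌋ ∧ h s t) (λ t → ⌊ t <? s ⌋ ∧ h s t)) ⟩
    ⊕ (λ s → ⊕ (λ t → ⌊ s <? t ⌋ ∧ h s t) xor ⊕ (λ t → ⌊ t <? s ⌋ ∧ h s t))
      ≡⟨ ⊕-xor (λ s → ⊕ λ t → ⌊ s <? t ⌋ ∧ h s t) (λ s → ⊕ λ t → ⌊ t <? s ⌋ ∧ h s t) ⟩
    ordered-part h xor ⊕ (λ s → ⊕ λ t → ⌊ t <? s ⌋ ∧ h s t)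
      ≡⟨ cong (ordered-part h xor_) (⊕-swap (λ s t → ⌊ t <? s ⌋ ∧ h s t)) ⟩
    ordered-part h xor ordered-part (λ s t → h t s) ∎
    where
    open ≡-Reasoning
    lt : ∀ {A : Set} (d : Dec A) → A → ⌊ d ⌋ ≡ true
    lt d a = trans (isYes≗does d) (dec-true d a)
    ge : ∀ {A : Set} (d : Dec A) → ¬ A → ⌊ d ⌋ ≡ false
    ge d a = trans (isYes≗does d) (dec-false d a)
    point : ∀ s t → h s t ≡ (⌊ s <? t ⌋ ∧ h s t) xor (⌊ t <? s ⌋ ∧ h s t)
    point s t with <-cmp s t
    ... | tri< a _ c rewrite lt (s <? t) a | ge (t <? s) c = sym (xor-identityʳ _)
    ... | tri> a _ c rewrite ge (s <? t) a | lt (t <? s) c = refl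
    ... | tri≈ a refl c rewrite ge (s <? s) a = diag s

  pairing : V n → V n → Fin n → Fin n → Bool
  pairing α β s t = lookup α s ∧ lookup β t ∧ adj Γ s t

  pairing-diag : ∀ α β s → pairing α β s s ≡ false
  pairing-diag α β s rewrite irrefl Γ s =
    truth-table 2 (λ x y → x ∧ y ∧ false) (λ _ _ → false) refl (lookup α s) (lookup β s)

  pairing-swap : ∀ α β s t → pairing α β t s ≡ pairing β α s t
  pairing-swap α β s t rewrite adj-sym Γ t s =
    truth-table 3 (λ x y a → x ∧ y ∧ a) (λ x y a → y ∧ x ∧ a) refl (lookup α t) (lookup β s) (adj Γ s t)

  ordered-part-cong : ∀ {g h} → (∀ s t → g s t ≡ h s t) → ordered-part g ≡ ordered-part h
  ordered-part-cong e = ⊕-cong λ s → ⊕-cong λ t → cong (⌊ s <? t ⌋ ∧_) (e s t)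

  B-split : ∀ α β → B Γ α β ≡ ordered-part (pairing α β) xor ordered-part (pairing β α)
  B-split α β = trans (⊕⊕-split (pairing α β) (pairing-diag α β))
    (cong (ordered-part (pairing α β) xor_) (ordered-part-cong (pairing-swap α β)))

  B-sym : ∀ α β → B Γ α β ≡ B Γ β α
  B-sym α β = trans (B-split α β) (trans (xor-comm (ordered-part (pairing α β)) _) (sym (B-split β α)))

  B-self : ∀ α → B Γ α α ≡ false
  B-self α = trans (B-split α α) (xor-same (ordered-part (pairing α α)))

  B-+ˡ : ∀ α β γ → B Γ (α +V β) γ ≡ B Γ α γ xor B Γ β γ
  B-+ˡ α β γ = trans
    (⊕-cong λ s → trans
      (⊕-cong λ t → trans (cong (λ x → x ∧ lookup γ t ∧ adj Γ s t) (lookup-zipWith _xor_ s α β))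
        (truth-table 3 (λ x y a → (x xor y) ∧ a) (λ x y a → (x ∧ a) xor (y ∧ a)) refl
          (lookup α s) (lookup β s) (lookup γ t ∧ adj Γ s t)))
      (⊕-xor (pairing α γ s) (pairing β γ s)))
    (⊕-xor (λ s → ⊕ (pairing α γ s)) (λ s → ⊕ (pairing β γ s)))

  B-basisʳ : ∀ α t → B Γ α (basis t) ≡ ⊕ λ s → lookup α s ∧ adj Γ s t
  B-basisʳ α t = ⊕-cong λ s → trans
    (sym (∧-⊕ (lookup α s) (λ u → lookup (basis t) u ∧ adj Γ s u)))
    (cong (lookup α s ∧_) (⊕-basis t (adj Γ s)))

  B-basis : ∀ s t → B Γ (basis s) (basis t) ≡ adj Γ s t
  B-basis s t = trans (B-basisʳ (basis s) t) (⊕-basis s (λ u → adj Γ u t))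

  -- The mixed terms of the expanded square are the two triangular halves of `B` in `B-split`.
  Q-+ : ∀ α β → Q Γ (α +V β) ≡ (Q Γ α xor Q Γ β) xor B Γ α β
  Q-+ α β = begin
    ⊕ (lookup (α +V β)) xor ordered-part (pairing (α +V β) (α +V β))
      ≡⟨ cong₂ _xor_ (trans (⊕-cong λ s → lookup-zipWith _xor_ s α β) (⊕-xor (lookup α) (lookup β)))
                     expand ⟩
    (⊕ (lookup α) xor ⊕ (lookup β)) xor ((p α α xor p β β) xor (p α β xor p β α))
      ≡⟨ truth-table 5 (λ a b c d x → (a xor b) xor ((c xor d) xor x))
                       (λ a b c d x → ((a xor c) xor (b xor d)) xor x) refl
           (⊕ (lookup α)) (⊕ (lookup β)) (p α α) (p β β) (p α β xor p β α) ⟩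
    (Q Γ α xor Q Γ β) xor (p α β xor p β α)
      ≡⟨ cong ((Q Γ α xor Q Γ β) xor_) (sym (B-split α β)) ⟩
    (Q Γ α xor Q Γ β) xor B Γ α β ∎
    where
    open ≡-Reasoning
    p : V n → V n → Bool
    p x y = ordered-part (pairing x y)
    expand : p (α +V β) (α +V β) ≡ (p α α xor p β β) xor (p α β xor p β α)
    expand = trans
      (ordered-part-cong λ s t → trans
        (cong₂ (λ x y → x ∧ y ∧ adj Γ s t) (lookup-zipWith _xor_ s α β) (lookup-zipWith _xor_ t α β))
        (truth-table 5 (λ x y z w a → (x xor y) ∧ (z xor w) ∧ a)
          (λ x y z w a → ((x ∧ z ∧ a) xor (y ∧ w ∧ a)) xor ((x ∧ w ∧ a) xor (y ∧ z ∧ a))) refl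
          (lookup α s) (lookup β s) (lookup α t) (lookup β t) (adj Γ s t)))
      (trans (ordered-part-xor (λ s t → pairing α α s t xor pairing β β s t)
                               (λ s t → pairing α β s t xor pairing β α s t))
        (cong₂ _xor_ (ordered-part-xor (pairing α α) (pairing β β))
                     (ordered-part-xor (pairing α β) (pairing β α))))

  Q-basis : ∀ s → Q Γ (basis s) ≡ true
  Q-basis s = cong₂ _xor_ linear quadratic
    where
    linear : ⊕ (lookup (basis s)) ≡ true
    linear = trans (⊕-cong λ t → truth-table 1 (λ x → x) (λ x → x ∧ true) refl (lookup (basis s) t))
                   (⊕-basis s (λ _ → true))
    quadratic : ordered-part (pairing (basis s) (basis s)) ≡ false
    quadratic = trans
      (⊕-cong λ u → trans (⊕-cong λ t → truth-table 4 (λ c x y a → c ∧ x ∧ y ∧ a) (λ c x y a → x ∧ y ∧ c ∧ a) refl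
                            ⌊ u <? t ⌋ (lookup (basis s) u) (lookup (basis s) t) (adj Γ u t))
        (trans (sym (∧-⊕ (lookup (basis s) u) (λ t → lookup (basis s) t ∧ ⌊ u <? t ⌋ ∧ adj Γ u t)))
               (cong (lookup (basis s) u ∧_) (⊕-basis s (λ t → ⌊ u <? t ⌋ ∧ adj Γ u t)))))
      (trans (⊕-basis s (λ u → ⌊ u <? s ⌋ ∧ adj Γ u s))
             (trans (cong (⌊ s <? s ⌋ ∧_) (irrefl Γ s))
                    (truth-table 1 (λ c → c ∧ false) (λ _ → false) refl ⌊ s <? s ⌋)))

-- Exhaustive search and pigeonhole in F₂-spaces

∀V? : ∀ {k} {P : V k → Set} → (∀ v → Dec (P v)) → Dec (∀ v → P v)
∀V? {zero}  P? = map′ (λ { p [] → p }) (λ p → p []) (P? [])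
∀V? {suc k} P? = map′ (λ { (p , _) (true ∷ v) → p v ; (_ , p) (false ∷ v) → p v })
                      (λ p → (λ v → p (true ∷ v)) , (λ v → p (false ∷ v)))
                      (∀V? (λ v → P? (true ∷ v)) ×-dec ∀V? (λ v → P? (false ∷ v)))

∀Bool? : {P : Bool → Set} → (∀ c → Dec (P c)) → Dec (∀ c → P c)
∀Bool? P? = map′ (λ { (p , _) true → p ; (_ , p) false → p }) (λ p → p true , p false) (P? true ×-dec P? false)

_≟V_ : ∀ {k} (u v : V k) → Dec (u ≡ v)
_≟V_ = ≡-dec Bool._≟_

encode : ∀ {n} → V n → Fin (2 ^ n)
encode []      = zero
encode (c ∷ x) = combine {2} (if c then 1F else 0F) (encode x)

encode-injective : ∀ {n} (x y : V n) → encode x ≡ encode y → x ≡ y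
encode-injective []      []      _ = refl
encode-injective (c ∷ x) (d ∷ y) e with combine-injective {2} (if c then 1F else 0F) (encode x) (if d then 1F else 0F) (encode y) e
... | e₁ , e₂ = cong₂ _∷_ (bit c d e₁) (encode-injective x y e₂)
  where
  bit : ∀ c d → _≡_ {A = Fin 2} (if c then 1F else 0F) (if d then 1F else 0F) → c ≡ d
  bit true  true  _ = refl
  bit false false _ = refl

iterate : ∀ {n} → (V n → V n) → ℕ → V n → V n
iterate h zero    x = x
iterate h (suc i) x = h (iterate h i x)

-- The iterates of y repeat; cancelling `h` on both sides of a repetition until one side is y itself
-- exhibits y as a value.
injective⇒surjective : ∀ {n} (h : V n → V n) → (∀ x y → h x ≡ h y → x ≡ y) → ∀ y → ∃[ x ] h x ≡ y
injective⇒surjective {n} h inj y with pigeonhole (ℕ.n<1+n (2 ^ n)) (λ i → encode (iterate h (toℕ i) y))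
... | i , j , i<j , e = unwind (toℕ i) (toℕ j) i<j (encode-injective _ _ e)
  where
  unwind : ∀ i j → i ℕ.< j → iterate h i y ≡ iterate h j y → ∃[ x ] h x ≡ y
  unwind zero    (suc j) _         e = iterate h j y , sym e
  unwind (suc i) (suc j) (ℕ.s≤s l) e = unwind i j l (inj _ _ e)

-- Transvections

module QuadraticSpace {n : ℕ} (b : V n → V n → Bool) (q : V n → Bool)
  (b-sym : ∀ x y → b x y ≡ b y x)
  (b-+ˡ : ∀ x y z → b (x +V y) z ≡ b x z xor b y z)
  (b-self : ∀ x → b x x ≡ false)
  (q-+ : ∀ x y → q (x +V y) ≡ (q x xor q y) xor b x y)
  where

  flip-b : ∀ {x y c} → b x y ≡ c → b y x ≡ c
  flip-b {x} {y} e = trans (b-sym y x) e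

  plusˡ : ∀ {x y z c d} → b x z ≡ c → b y z ≡ d → b (x +V y) z ≡ c xor d
  plusˡ {x} {y} {z} e f = trans (b-+ˡ x y z) (cong₂ _xor_ e f)

  plusʳ : ∀ {x y z c d} → b z x ≡ c → b z y ≡ d → b z (x +V y) ≡ c xor d
  plusʳ e f = flip-b (plusˡ (flip-b e) (flip-b f))

  plus-q : ∀ {x y c d e} → q x ≡ c → q y ≡ d → b x y ≡ e → q (x +V y) ≡ (c xor d) xor e
  plus-q {x} {y} ec ed ee = trans (q-+ x y) (cong₂ _xor_ (cong₂ _xor_ ec ed) ee)

  b-0ˡ : ∀ x → b 0V x ≡ false
  b-0ˡ x = trans (cong (λ z → b z x) (sym (+V-self 0V)))
                 (trans (b-+ˡ 0V 0V x) (Bool.xor-same (b 0V x)))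

  b-0ʳ : ∀ x → b x 0V ≡ false
  b-0ʳ x = flip-b (b-0ˡ x)

  q-0 : q 0V ≡ false
  q-0 = trans (cong q (sym (+V-self 0V)))
              (trans (plus-q refl refl (b-self 0V)) (cong (_xor false) (Bool.xor-same (q 0V))))

  q-true⇒≢0 : ∀ {x} → q x ≡ true → x ≢ 0V
  q-true⇒≢0 e refl = true≢false e q-0

  -- Polarization: an additive map preserving `q` preserves `b`, and two vectors of value 1 whose
  -- sum also has value 1 are never orthogonal.
  b≡q-defect : ∀ x y → b x y ≡ (q x xor q y) xor q (x +V y)
  b≡q-defect x y = trans
    (truth-table 3 (λ u v w → w) (λ u v w → (u xor v) xor ((u xor v) xor w)) refl (q x) (q y) (b x y))
    (cong ((q x xor q y) xor_) (sym (q-+ x y)))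

  T : V n → V n → V n
  T v x = x +V (b x v · v)

  T-moves : ∀ {v x} → b x v ≡ true → T v x ≡ x +V v
  T-moves {v} {x} e = cong (λ c → x +V (c · v)) e

  T-fixes : ∀ {v x} → b x v ≡ false → T v x ≡ x
  T-fixes {v} {x} e = trans (cong (λ c → x +V (c · v)) e) (+V-identityʳ x)

  T-involutive : ∀ v x → T v (T v x) ≡ x
  T-involutive v x with b x v in e
  ... | true  = trans (T-moves (plusˡ e (b-self v))) (vsolve ((#0 ⊞ #1) ⊞ #1) #0 refl (x ∷ v ∷ []))
  ... | false = trans (T-fixes (plusˡ e (b-0ˡ v))) (+V-identityʳ x)

  -- Conjugating `T w` by `T v` gives the transvection in the image `T v w`, which is `v +V w` here.
  T-conjugate : ∀ {v w} → b v w ≡ true → T v ∘ T w ∘ T v ≗ T (v +V w)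
  T-conjugate {v} {w} vw x with b x v in ev | b x w in ew
  ... | true | true = begin
    T v (T w (x +V v))  ≡⟨ cong (T v) (T-fixes (plusˡ ew vw)) ⟩
    T v (x +V v)        ≡⟨ T-moves (plusˡ ev (b-self v)) ⟩
    (x +V v) +V v       ≡⟨ vsolve ((#0 ⊞ #1) ⊞ #1) #0 refl (x ∷ v ∷ []) ⟩
    x                   ≡⟨ sym (T-fixes (plusʳ ev ew)) ⟩
    T (v +V w) x        ∎
    where open ≡-Reasoning
  ... | true | false = begin
    T v (T w (x +V v))  ≡⟨ cong (T v) (T-moves (plusˡ ew vw)) ⟩
    T v ((x +V v) +V w) ≡⟨ T-fixes (plusˡ (plusˡ ev (b-self v)) (flip-b vw)) ⟩
    (x +V v) +V w       ≡⟨ +V-assoc x v w ⟩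
    x +V (v +V w)       ≡⟨ sym (T-moves (plusʳ ev ew)) ⟩
    T (v +V w) x        ∎
    where open ≡-Reasoning
  ... | false | true = begin
    T v (T w (x +V 0V)) ≡⟨ cong (T v ∘ T w) (+V-identityʳ x) ⟩
    T v (T w x)         ≡⟨ cong (T v) (T-moves ew) ⟩
    T v (x +V w)        ≡⟨ T-moves (plusˡ ev (flip-b vw)) ⟩
    (x +V w) +V v       ≡⟨ vsolve ((#0 ⊞ #2) ⊞ #1) (#0 ⊞ (#1 ⊞ #2)) refl (x ∷ v ∷ w ∷ []) ⟩
    x +V (v +V w)       ≡⟨ sym (T-moves (plusʳ ev ew)) ⟩
    T (v +V w) x        ∎
    where open ≡-Reasoning
  ... | false | false = begin
    T v (T w (x +V 0V)) ≡⟨ cong (T v ∘ T w) (+V-identityʳ x) ⟩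
    T v (T w x)         ≡⟨ cong (T v) (T-fixes ew) ⟩
    T v x               ≡⟨ T-fixes ev ⟩
    x                   ≡⟨ sym (T-fixes (plusʳ ev ew)) ⟩
    T (v +V w) x        ∎
    where open ≡-Reasoning

  record Isometry (σ : V n → V n) : Set where
    field
      additive    : ∀ x y → σ (x +V y) ≡ σ x +V σ y
      q-preserved : ∀ x → q (σ x) ≡ q x

    b-preserved : ∀ x y → b (σ x) (σ y) ≡ b x y
    b-preserved x y = begin
      b (σ x) (σ y)                                    ≡⟨ b≡q-defect (σ x) (σ y) ⟩
      (q (σ x) xor q (σ y)) xor q (σ x +V σ y)
        ≡⟨ cong₂ _xor_ (cong₂ _xor_ (q-preserved x) (q-preserved y))
                       (trans (cong q (sym (additive x y))) (q-preserved (x +V y))) ⟩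
      (q x xor q y) xor q (x +V y)                     ≡⟨ sym (b≡q-defect x y) ⟩
      b x y                                            ∎
      where open ≡-Reasoning

    zero-preserved : σ 0V ≡ 0V
    zero-preserved = begin
      σ 0V          ≡⟨ cong σ (sym (+V-self 0V)) ⟩
      σ (0V +V 0V)  ≡⟨ additive 0V 0V ⟩
      σ 0V +V σ 0V  ≡⟨ +V-self (σ 0V) ⟩
      0V            ∎
      where open ≡-Reasoning

  open Isometry public

  id-isometry : Isometry id
  id-isometry = record { additive = λ _ _ → refl ; q-preserved = λ _ → refl }

  ∘-isometry : ∀ {σ τ} → Isometry σ → Isometry τ → Isometry (σ ∘ τ)
  ∘-isometry {σ} {τ} s t = record
    { additive    = λ x y → trans (cong σ (additive t x y)) (additive s (τ x) (τ y))
    ; q-preserved = λ x → trans (q-preserved s (τ x)) (q-preserved t x)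
    }

  T-isometry : ∀ {v} → q v ≡ true → Isometry (T v)
  T-isometry {v} qv = record { additive = add ; q-preserved = pres }
    where
    add : ∀ x y → T v (x +V y) ≡ T v x +V T v y
    add x y = trans
      (cong ((x +V y) +V_) (trans (cong (_· v) (b-+ˡ x y v)) (·-distrib-xor (b x v) (b y v) v)))
      (+V-interchange x y _ _)
    pres : ∀ x → q (T v x) ≡ q x
    pres x with b x v in e
    ... | true  = trans (plus-q refl qv e) (truth-table 1 (λ c → (c xor true) xor true) (λ c → c) refl (q x))
    ... | false = cong q (+V-identityʳ x)

-- Points, colourings and edges

-- `three` means at least three; the other constructors account for every index with value `d`.
data Count {m : ℕ} (c : Fin m → Bool) (d : Bool) : Set where
  none  : (∀ i → c i ≡ not d) → Count c d
  one   : ∀ i → c i ≡ d → (∀ j → j ≢ i → c j ≡ not d) → Count c d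
  two   : ∀ i j → i ≢ j → c i ≡ d → c j ≡ d → (∀ k → k ≢ i → k ≢ j → c k ≡ not d) → Count c d
  three : ∀ i j k → i ≢ j → i ≢ k → j ≢ k → c i ≡ d → c j ≡ d → c k ≡ d → Count c d

count : ∀ {m} (c : Fin m → Bool) d → Count c d
count c d with any? (λ i → c i Bool.≟ d)
... | no ¬a = none λ i → ¬-not λ e → ¬a (i , e)
... | yes (i , ci) with any? (λ j → ¬? (i ≟ j) ×-dec c j Bool.≟ d)
...   | no ¬a = one i ci λ j j≢i → ¬-not λ e → ¬a (j , j≢i ∘ sym , e)
...   | yes (j , i≢j , cj) with any? (λ k → ¬? (i ≟ k) ×-dec (¬? (j ≟ k) ×-dec c k Bool.≟ d))
...     | no ¬a = two i j i≢j ci cj λ k k≢i k≢j → ¬-not λ e → ¬a (k , k≢i ∘ sym , k≢j ∘ sym , e)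
...     | yes (k , i≢k , j≢k , ck) = three i j k i≢j i≢k j≢k ci cj ck

δ : ∀ {m} → Fin m → Fin m → Bool
δ i j = ⌊ i ≟ j ⌋

-- The number of common endpoints mod 2. Distinct edges share at most one, so this is adjacency in a
-- line graph; an edge against itself gives 0, as in an alternating form.
incidence : ∀ {m} → Fin m × Fin m → Fin m × Fin m → Bool
incidence (i , j) (k , l) = (δ i k xor δ i l) xor (δ j k xor δ j l)

incident⇒share : ∀ {m} (x y : Fin m × Fin m) → incidence x y ≡ true → ShareEndpoint x y
incident⇒share (i , j) (k , l) h with i ≟ k | i ≟ l | j ≟ k | j ≟ l
... | yes e | _     | _     | _     = inj₁ e
... | no _  | yes e | _     | _     = inj₂ (inj₁ e)
... | no _  | no _  | yes e | _     = inj₂ (inj₂ (inj₁ e))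
... | no _  | no _  | no _  | yes e = inj₂ (inj₂ (inj₂ e))
... | no _  | no _  | no _  | no _  = contradiction h λ ()

share⇒incident : ∀ {m} (x y : Fin m × Fin m) → proj₁ x < proj₂ x → proj₁ y < proj₂ y → x ≢ y →
                 ShareEndpoint x y → incidence x y ≡ true
share⇒incident (i , j) (k , l) i<j k<l x≢y sh with i ≟ k | i ≟ l | j ≟ k | j ≟ l
... | yes refl | yes refl | _        | _        = contradiction k<l (<-irrefl refl)
... | yes refl | no _     | yes refl | _        = contradiction i<j (<-irrefl refl)
... | yes refl | no _     | no _     | yes refl = contradiction refl x≢y
... | yes refl | no _     | no _     | no _     = refl
... | no _     | yes refl | yes refl | _        = contradiction i<j (<-asym k<l)
... | no _     | yes refl | no _     | yes refl = contradiction i<j (<-irrefl refl)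
... | no _     | yes refl | no _     | no _     = refl
... | no _     | no _     | yes refl | yes refl = contradiction k<l (<-irrefl refl)
... | no _     | no _     | yes refl | no _     = refl
... | no _     | no _     | no _     | yes refl = refl
... | no ik    | no il    | no jk    | no jl    = contradiction sh [ ik , [ il , [ jk , jl ]′ ]′ ]′

choose : ∀ {k} {A : Set} {K : Fin k → Set} → (∀ s → A ⊎ K s) → A ⊎ (∀ s → K s)
choose {zero}  f = inj₂ λ ()
choose {suc k} f with f zero | choose (f ∘ suc)
... | inj₁ a  | _       = inj₁ a
... | inj₂ _  | inj₁ a  = inj₁ a
... | inj₂ k₀ | inj₂ ks = inj₂ λ { zero → k₀ ; (suc s) → ks s }

-- The Dynkin diagram of type E₆: the path 1 – 2 – 3 – 4 – 5 with 0 attached to 3.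

E₆-adj : Fin 6 → Fin 6 → Bool
E₆-adj 0F 3F = true
E₆-adj 3F 0F = true
E₆-adj 1F 2F = true
E₆-adj 2F 1F = true
E₆-adj 2F 3F = true
E₆-adj 3F 2F = true
E₆-adj 3F 4F = true
E₆-adj 4F 3F = true
E₆-adj 4F 5F = true
E₆-adj 5F 4F = true
E₆-adj _  _  = false

E₆ : Graph 6
E₆ = record
  { adj     = E₆-adj
  ; adj-sym = from-yes (all? λ s → all? λ t → E₆-adj s t Bool.≟ E₆-adj t s)
  ; irrefl  = from-yes (all? λ s → E₆-adj s s Bool.≟ false)
  }

halves : Bool → Vec Bool 6
halves d = d ∷ d ∷ d ∷ not d ∷ not d ∷ not d ∷ []

-- Six points coloured three and three change colour once along the path, at its middle step; that
-- step is node 3, where node 0 is attached.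
colour-change : ∀ d (i : Fin 5) → lookup (halves d) (inject₁ i) xor lookup (halves d) (suc i) ≡ E₆-adj 0F (suc i)
colour-change = from-yes (∀Bool? λ d → all? λ i →
  (lookup (halves d) (inject₁ i) xor lookup (halves d) (suc i)) Bool.≟ E₆-adj 0F (suc i))

path-gram : ∀ (i j : Fin 5) → incidence (inject₁ i , suc i) (inject₁ j , suc j) ≡ E₆-adj (suc i) (suc j)
path-gram = from-yes (all? λ i → all? λ j →
  incidence (inject₁ i , suc i) (inject₁ j , suc j) Bool.≟ E₆-adj (suc i) (suc j))

-- Finite computations in the E₆ space over F₂

InSpan : ∀ {n} → List (V n) → V n → Set
InSpan []       x = x ≡ 0V
InSpan (y ∷ ys) x = InSpan ys x ⊎ InSpan ys (x +V y)

inSpan? : ∀ {n} (ys : List (V n)) x → Dec (InSpan ys x)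
inSpan? []       x = x ≟V 0V
inSpan? (y ∷ ys) x = inSpan? ys x ⊎-dec inSpan? ys (x +V y)

-- A standard nonzero vector for each value of `q₆`: a simple root has value 1, the sum of two
-- orthogonal ones has value 0.
anchor : Bool → V 6
anchor true  = basis 0F
anchor false = basis 0F +V basis 1F

opaque
  b₆ : V 6 → V 6 → Bool
  b₆ = B E₆

  q₆ : V 6 → Bool
  q₆ = Q E₆

-- Follows the closure rule `Refl-+`, so that a derivation here can be replayed for roots in V.
data Generated : V 6 → Set where
  simple : ∀ i → Generated (basis i)
  sum    : ∀ {u v} → Generated u → Generated v → b₆ u v ≡ true → Generated (u +V v)

-- An isometry fixing xs sends t to such a c; the alternatives return c to t by zero, one or two
-- reflections that fix xs.
Stage : List (V 6) → V 6 → Set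
Stage xs t = ∀ c → q₆ c ≡ q₆ t → All (λ x → b₆ c x ≡ b₆ t x) xs →
  c ≡ t ⊎ b₆ c t ≡ true ⊎ ∃[ w ] (q₆ w ≡ true × b₆ w c ≡ true × b₆ w t ≡ true × All (λ x → b₆ w x ≡ false) xs)

-- The first list holds the vectors already fixed, latest first; hence the reversal `ʳ++` in
-- `targets-span` and `fix-in-U`.
Stages : List (V 6) → List (V 6) → Set
Stages xs []       = ⊤
Stages xs (t ∷ ts) = Stage xs t × Stages (t ∷ xs) ts

-- In this order two reflections suffice at every stage; no ordering of the six simple roots has that property.
opaque
  targets : List (V 6)
  targets = basis 0F ∷ (basis 3F +V basis 5F) ∷ basis 5F ∷ basis 4F ∷ basis 1F ∷ basis 2F ∷ []

first : ∀ {k} {A : Set} → (Fin k → Maybe A) → Maybe A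
first {zero}  f = nothing
first {suc k} f = f zero <∣> first (f ∘ suc)

opaque
  unfolding b₆ q₆ targets

  b₆-sym : ∀ u v → b₆ u v ≡ b₆ v u
  b₆-sym = B-sym E₆

  b₆-+ˡ : ∀ u v w → b₆ (u +V v) w ≡ b₆ u w xor b₆ v w
  b₆-+ˡ = B-+ˡ E₆

  b₆-self : ∀ u → b₆ u u ≡ false
  b₆-self = B-self E₆

  q₆-+ : ∀ u v → q₆ (u +V v) ≡ (q₆ u xor q₆ v) xor b₆ u v
  q₆-+ = Q-+ E₆

  b₆-basis : ∀ i j → b₆ (basis i) (basis j) ≡ adj E₆ i j
  b₆-basis = B-basis E₆

  q₆-basis : ∀ i → q₆ (basis i) ≡ true
  q₆-basis = Q-basis E₆

  -- The E₆ Cartan matrix has determinant 3, so the form stays nondegenerate mod 2.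
  E₆-dual : ∀ f → ∃[ u ] (∀ i → b₆ u (basis i) ≡ lookup f i)
  E₆-dual = from-yes (∀V? λ f → anySubset? λ u → all? λ i → b₆ u (basis i) Bool.≟ lookup f i)

  -- Serves `good-+`: a vector of U is distributed over two cosets so that both summands get total
  -- value 1.
  E₆-split : ∀ u → u ≢ 0V → ∀ c d → ∃[ v ] (v ≢ 0V × v +V u ≢ 0V × q₆ v ≡ c × q₆ (v +V u) ≡ d)
  E₆-split = from-yes (∀V? λ u → ¬? (u ≟V 0V) →-dec ∀Bool? λ c → ∀Bool? λ d → anySubset? λ v →
    ¬? (v ≟V 0V) ×-dec ¬? ((v +V u) ≟V 0V) ×-dec q₆ v Bool.≟ c ×-dec q₆ (v +V u) Bool.≟ d)

  -- Serves `move-to-U⊥`: a correction from U can meet a condition on a pairing and one on the value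
  -- at the same time.
  E₆-solve : ∀ u → u ≢ 0V → ∀ c d → ∃[ v ] (b₆ v u ≡ c × q₆ v ≡ d)
  E₆-solve = from-yes (∀V? λ u → ¬? (u ≟V 0V) →-dec ∀Bool? λ c → ∀Bool? λ d → anySubset? λ v →
    b₆ v u Bool.≟ c ×-dec q₆ v Bool.≟ d)

  anchor≢0 : ∀ c → anchor c ≢ 0V
  anchor≢0 = from-yes (∀Bool? λ c → ¬? (anchor c ≟V 0V))

  q₆-anchor : ∀ c → q₆ (anchor c) ≡ c
  q₆-anchor = from-yes (∀Bool? λ c → q₆ (anchor c) Bool.≟ c)

  -- Supplies the detour from u to an anchor: an intermediate vector with the value of u in
  -- `to-anchor`, a reflecting vector of value 1 in `move-to-anchor`.
  E₆-bridge : ∀ u → u ≢ 0V → ∀ c d → ∃[ w ] (q₆ w ≡ d × b₆ w u ≡ true × b₆ w (anchor c) ≡ true)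
  E₆-bridge = from-yes (∀V? λ u → ¬? (u ≟V 0V) →-dec ∀Bool? λ c → ∀Bool? λ d → anySubset? λ w →
    q₆ w Bool.≟ d ×-dec b₆ w u Bool.≟ true ×-dec b₆ w (anchor c) Bool.≟ true)

  is-simple : ∀ u → Maybe (Generated u)
  is-simple u = first λ i → simple-at i (basis i ≟V u)
    where
    simple-at : ∀ i → Dec (basis i ≡ u) → Maybe (Generated u)
    simple-at i (yes refl) = just (simple i)
    simple-at i (no _)     = nothing

  -- Searches backwards: adding a simple root not orthogonal to u undoes one `sum`. `allowed`
  -- restricts the simple roots tried, and `base` is consulted at every depth.
  descend : (V 6 → Fin 6 → Bool) → (∀ u → Maybe (Generated u)) → ℕ → ∀ u → Maybe (Generated u)
  descend allowed base zero    u = base u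
  descend allowed base (suc d) u = base u <∣> first λ i → add-simple i (allowed u i Bool.≟ true) (b₆ (u +V basis i) (basis i) Bool.≟ true)
    where
    add-simple : ∀ i → Dec (allowed u i ≡ true) → Dec (b₆ (u +V basis i) (basis i) ≡ true) → Maybe (Generated u)
    add-simple i (yes _) (yes e) = Maybe.map
      (λ g → subst Generated (vsolve ((#0 ⊞ #1) ⊞ #1) #0 refl (u ∷ basis i ∷ [])) (sum g (simple i) e))
      (descend allowed base d (u +V basis i))
    add-simple i _       _       = nothing

  -- Each of up to five arbitrary steps first tries to finish by shrinking the support, which keeps the search small.
  generate : ∀ u → Maybe (Generated u)
  generate = descend (λ _ _ → true) (descend lookup is-simple 6) 5

  -- The 36 vectors of value 1 are the positive roots of E₆ mod 2, each built up from simple roots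
  -- by non-orthogonal sums.
  E₆-generated : ∀ u → q₆ u ≡ true → Generated u
  E₆-generated u e = to-witness (found u e)
    where
    found : ∀ u → q₆ u ≡ true → Is-just (generate u)
    found = from-yes (∀V? λ u → (q₆ u Bool.≟ true) →-dec MaybeAny.dec (λ _ → yes tt) (generate u))

  stage? : ∀ xs t → Dec (Stage xs t)
  stage? xs t = ∀V? λ c → (q₆ c Bool.≟ q₆ t) →-dec All.all? (λ x → b₆ c x Bool.≟ b₆ t x) xs →-dec
    (c ≟V t ⊎-dec b₆ c t Bool.≟ true ⊎-dec anySubset? λ w → q₆ w Bool.≟ true ×-dec b₆ w c Bool.≟ true ×-dec
       b₆ w t Bool.≟ true ×-dec All.all? (λ x → b₆ w x Bool.≟ false) xs)

  stages? : ∀ xs ts → Dec (Stages xs ts)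
  stages? xs []       = yes tt
  stages? xs (t ∷ ts) = stage? xs t ×-dec stages? (t ∷ xs) ts

  E₆-stages : Stages [] targets
  E₆-stages = from-yes (stages? [] targets)

  targets-span : ∀ u → InSpan (targets ʳ++ []) u
  targets-span = from-yes (∀V? (inSpan? (targets ʳ++ [])))

-- The group G generated by the transvections in the `α s`

module Reflections {n : ℕ} (b : V n → V n → Bool) (q : V n → Bool)
  (b-sym : ∀ x y → b x y ≡ b y x)
  (b-+ˡ : ∀ x y z → b (x +V y) z ≡ b x z xor b y z)
  (b-self : ∀ x → b x x ≡ false)
  (q-+ : ∀ x y → q (x +V y) ≡ (q x xor q y) xor b x y)
  {k : ℕ} (α : Fin k → V n) (q-α : ∀ s → q (α s) ≡ true)
  (nondegenerate : ∀ v → (∀ s → b v (α s) ≡ false) → v ≡ 0V)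
  where

  open QuadraticSpace b q b-sym b-+ˡ b-self q-+ public

  nonorthogonal : ∀ v → v ≢ 0V → ∃[ s ] b v (α s) ≡ true
  nonorthogonal v v≢0 with any? (λ s → b v (α s) Bool.≟ true)
  ... | yes found = found
  ... | no ¬found = contradiction (nondegenerate v λ s → ¬-not λ e → ¬found (s , e)) v≢0

  Φ : List (Fin k) → V n → V n
  Φ = foldr (λ s h → T (α s) ∘ h) id

  Φ-++ : ∀ w w' → Φ (w ++ w') ≗ Φ w ∘ Φ w'
  Φ-++ []      w' x = refl
  Φ-++ (s ∷ w) w' x = cong (T (α s)) (Φ-++ w w' x)

  Φ-isometry : ∀ w → Isometry (Φ w)
  Φ-isometry []      = id-isometry
  Φ-isometry (s ∷ w) = ∘-isometry (T-isometry (q-α s)) (Φ-isometry w)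

  Φ-reverseˡ : ∀ w → Φ (reverse w) ∘ Φ w ≗ id
  Φ-reverseˡ []      x = refl
  Φ-reverseˡ (s ∷ w) x = begin
    Φ (reverse (s ∷ w)) (T (α s) (Φ w x))       ≡⟨ cong (λ r → Φ r (T (α s) (Φ w x))) (unfold-reverse s w) ⟩
    Φ (reverse w ++ [ s ]) (T (α s) (Φ w x))    ≡⟨ Φ-++ (reverse w) [ s ] _ ⟩
    Φ (reverse w) (T (α s) (T (α s) (Φ w x)))   ≡⟨ cong (Φ (reverse w)) (T-involutive (α s) (Φ w x)) ⟩
    Φ (reverse w) (Φ w x)                       ≡⟨ Φ-reverseˡ w x ⟩
    x                                           ∎
    where open ≡-Reasoning

  Φ-reverseʳ : ∀ w → Φ w ∘ Φ (reverse w) ≗ id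
  Φ-reverseʳ []      x = refl
  Φ-reverseʳ (s ∷ w) x = begin
    T (α s) (Φ w (Φ (reverse (s ∷ w)) x))       ≡⟨ cong (λ r → T (α s) (Φ w (Φ r x))) (unfold-reverse s w) ⟩
    T (α s) (Φ w (Φ (reverse w ++ [ s ]) x))    ≡⟨ cong (T (α s) ∘ Φ w) (Φ-++ (reverse w) [ s ] x) ⟩
    T (α s) (Φ w (Φ (reverse w) (T (α s) x)))   ≡⟨ cong (T (α s)) (Φ-reverseʳ w _) ⟩
    T (α s) (T (α s) x)                         ≡⟨ T-involutive (α s) x ⟩
    x                                           ∎
    where open ≡-Reasoning

  Φ-connect : ∀ {x y z} w v → Φ w x ≡ z → Φ v y ≡ z → ∃[ u ] Φ u x ≡ y
  Φ-connect {x} {y} {z} w v wx vy = reverse v ++ w , (begin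
    Φ (reverse v ++ w) x   ≡⟨ Φ-++ (reverse v) w x ⟩
    Φ (reverse v) (Φ w x)  ≡⟨ cong (Φ (reverse v)) (trans wx (sym vy)) ⟩
    Φ (reverse v) (Φ v y)  ≡⟨ Φ-reverseˡ v y ⟩
    y                      ∎)
    where open ≡-Reasoning

  InG : (V n → V n) → Set
  InG σ = ∃[ w ] Φ w ≗ σ

  InG-∘ : ∀ {σ τ} → InG σ → InG τ → InG (σ ∘ τ)
  InG-∘ {σ} {τ} (w , e) (w' , e') =
    w ++ w' , λ x → trans (Φ-++ w w' x) (trans (cong (Φ w) (e' x)) (e (τ x)))

  -- The roots of the overview.
  Refl : V n → Set
  Refl v = q v ≡ true × InG (T v)

  Refl-α : ∀ s → Refl (α s)
  Refl-α s = q-α s , [ s ] , λ _ → refl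

  Refl-+ : ∀ {v w} → Refl v → Refl w → b v w ≡ true → Refl (v +V w)
  Refl-+ {v} {w} (qv , gv) (qw , gw) vw =
    plus-q qv qw vw ,
    let u , e = InG-∘ gv (InG-∘ gw gv) in u , λ x → trans (e x) (T-conjugate vw x)

  -- Systems of type A and E₆ among the roots

  record E₆-Roots : Set where
    field
      e      : Fin 6 → V n
      e-Refl : ∀ i → Refl (e i)
      gram   : ∀ i j → b (e i) (e j) ≡ adj E₆ i j

  -- A frame is a family of points whose pairwise sums behave like the
  -- transpositions of a symmetric group (the root system of type A).
  Frame : ∀ {m} → (Fin m → V n) → Set
  Frame p = ∀ i j → i ≢ j → Refl (p i +V p j)

  -- Tested on sums of two points only, since translating all points by one vector leaves a frame a
  -- frame.
  Orthogonal : ∀ {m} → (Fin m → V n) → V n → Set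
  Orthogonal p x = ∀ i j → b x (p i +V p j) ≡ false

  Orthogonal-+ : ∀ {m} {p : Fin m → V n} {x y} → Orthogonal p x → Orthogonal p y → Orthogonal p (x +V y)
  Orthogonal-+ ox oy i j = plusˡ (ox i j) (oy i j)

  extend : ∀ {m} → (Fin m → V n) → V n → Fin (suc m) → V n
  extend p x zero    = x
  extend p x (suc i) = p i

  -- The new point differs from `p i` by `a`, and from any other `p j` by the sum of the
  -- non-orthogonal roots `a` and `p i +V p j`.
  extend-frame : ∀ {m} {p : Fin m → V n} → Frame p → ∀ i {a} → Refl a →
                 (∀ j → j ≢ i → b a (p i +V p j) ≡ true) → Frame (extend p (p i +V a))
  extend-frame {p = p} frame i {a} Ra ba = go
    where
    new : ∀ j → Refl ((p i +V a) +V p j)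
    new j with j ≟ i
    ... | yes refl = subst Refl (vsolve #1 ((#0 ⊞ #1) ⊞ #0) refl (p i ∷ a ∷ [])) Ra
    ... | no  j≢i  = subst Refl (vsolve (#1 ⊞ (#0 ⊞ #2)) ((#0 ⊞ #1) ⊞ #2) refl (p i ∷ a ∷ p j ∷ []))
                       (Refl-+ Ra (frame i j (j≢i ∘ sym)) (ba j j≢i))
    go : Frame (extend p (p i +V a))
    go zero    zero    0≢0 = contradiction refl 0≢0
    go zero    (suc j) _   = new j
    go (suc j) zero    _   = subst Refl (+V-comm (p i +V a) (p j)) (new j)
    go (suc j) (suc l) j≢l = frame j l (j≢l ∘ cong suc)

  module _ {m : ℕ} {p : Fin m → V n} (frame : Frame p) where

    r : Fin m → Fin m → V n
    r i j = p i +V p j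

    r-trans : ∀ i j l → r i j +V r j l ≡ r i l
    r-trans i j l = vsolve ((#0 ⊞ #1) ⊞ (#1 ⊞ #2)) (#0 ⊞ #2) refl (p i ∷ p j ∷ p l ∷ [])

    r-comm : ∀ i j → r i j ≡ r j i
    r-comm i j = +V-comm (p i) (p j)

    r-self : ∀ i → r i i ≡ 0V
    r-self i = +V-self (p i)

    r≢0 : ∀ i j → i ≢ j → r i j ≢ 0V
    r≢0 i j i≢j = q-true⇒≢0 (proj₁ (frame i j i≢j))

    p-injective : ∀ i j → p i ≡ p j → i ≡ j
    p-injective i j e with i ≟ j
    ... | yes i≡j = i≡j
    ... | no  i≢j = contradiction (trans (cong (_+V p j) e) (+V-self (p j))) (r≢0 i j i≢j)

    -- Three vectors of value 1 with sum 0: polarization gives 1 + 1 + 1 = 1.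
    meet : ∀ i j l → i ≢ j → i ≢ l → j ≢ l → b (r i j) (r j l) ≡ true
    meet i j l i≢j i≢l j≢l = trans (b≡q-defect (r i j) (r j l))
      (cong₂ _xor_ (cong₂ _xor_ (proj₁ (frame i j i≢j)) (proj₁ (frame j l j≢l)))
                   (trans (cong q (r-trans i j l)) (proj₁ (frame i l i≢l))))

    -- `r k l` is the sum of `r j k` and `r j l`, each of which meets `r i j`: 1 + 1 = 0.
    disjoint : ∀ i j k l → i ≢ j → k ≢ l → i ≢ k → i ≢ l → j ≢ k → j ≢ l → b (r i j) (r k l) ≡ false
    disjoint i j k l ij kl ik il jk jl = trans
      (cong (b (r i j)) (vsolve (#1 ⊞ #2) ((#0 ⊞ #1) ⊞ (#0 ⊞ #2)) refl (p j ∷ p k ∷ p l ∷ [])))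
      (plusʳ (meet i j k ij ik jk) (meet i j l ij il jl))

    -- Sums of two points pair like edges of the complete graph on the points; the cases i = j and k
    -- = l, where a sum is 0, agree as well.
    b-r : ∀ i j k l → b (r i j) (r k l) ≡ incidence (i , j) (k , l)
    b-r i j k l with i ≟ j | k ≟ l
    ... | yes refl | _ = trans (cong (λ x → b x (r k l)) (r-self i))
            (trans (b-0ˡ _) (sym (Bool.xor-same (δ i k xor δ i l))))
    ... | no _ | yes refl = trans (cong (b (r i j)) (r-self k))
            (trans (b-0ʳ _) (sym (cong₂ _xor_ (Bool.xor-same (δ i k)) (Bool.xor-same (δ j k)))))
    ... | no ij | no kl with i ≟ k | i ≟ l | j ≟ k | j ≟ l
    ...   | yes refl | yes refl | _ | _ = contradiction refl kl
    ...   | yes refl | no _ | yes refl | _ = contradiction refl ij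
    ...   | yes refl | no _ | no _ | yes refl = b-self _
    ...   | yes refl | no il | no jk | no jl = trans (cong (λ x → b x (r i l)) (r-comm i j)) (meet j i l jk jl il)
    ...   | no _ | yes refl | _ | yes refl = contradiction refl ij
    ...   | no _ | yes refl | yes refl | no _ = trans (cong (λ x → b x (r j i)) (r-comm i j)) (b-self _)
    ...   | no ik | yes refl | no jk | no jl =
            trans (cong₂ b (r-comm i j) (r-comm k i)) (meet j i k jl jk ik)
    ...   | no _ | no _ | yes refl | yes refl = contradiction refl kl
    ...   | no ik | no il | yes refl | no jl = meet i j l ij il jl
    ...   | no ik | no il | no jk | yes refl = trans (cong (b (r i j)) (r-comm k j)) (meet i j k ij ik jk)
    ...   | no ik | no il | no jk | no jl = disjoint i j k l ij kl ik il jk jl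

    module _ {z : V n} (z⊥ : Orthogonal p z) where

      -- Since z is orthogonal to the frame, adding it changes no pairing with a frame root, so the
      -- endpoint can be moved as for z = 0.
      shift-endpoint : ∀ i j l → i ≢ l → i ≢ j → Refl (r i j +V z) → Refl (r i l +V z)
      shift-endpoint i j l i≢l i≢j R with j ≟ l
      ... | yes refl = R
      ... | no  j≢l  = subst Refl
        (vsolve (((#0 ⊞ #1) ⊞ #3) ⊞ (#1 ⊞ #2)) ((#0 ⊞ #2) ⊞ #3) refl (p i ∷ p j ∷ p l ∷ z ∷ []))
        (Refl-+ R (frame j l j≢l) (plusˡ (meet i j l i≢j i≢l j≢l) (z⊥ j l)))

      shift-edge : ∀ i j k l → i ≢ j → k ≢ l → Refl (r i j +V z) → Refl (r k l +V z)
      shift-edge i j k l i≢j k≢l R with i ≟ k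
      ... | yes refl = shift-endpoint i j l k≢l i≢j R
      ... | no  i≢k  = shift-endpoint k i l k≢l (i≢k ∘ sym)
        (subst (λ x → Refl (x +V z)) (r-comm i k) (shift-endpoint i j k i≢k i≢j R))

    -- Moving one point by z and adjoining another one moved by z' makes room for one more point.
    enlarge : ∀ i j {z z'} → i ≢ j → Orthogonal p z → Orthogonal p z' → b z z' ≡ true →
              Refl (r i j +V z) → Refl (r i j +V z') → ∃[ p' ] Frame {suc m} p'
    enlarge i j {z} {z'} i≢j z⊥ z'⊥ zz' R R' = _ , extend-frame frame' i R' sees
      where
      p' : Fin m → V n
      p' l = p l +V (δ l j · z)
      p'-off : ∀ l → l ≢ j → p' l ≡ p l
      p'-off l e = trans (cong (λ c → p l +V (c · z)) (trans (isYes≗does (l ≟ j)) (dec-false (l ≟ j) e)))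
                         (+V-identityʳ _)
      p'-at : p' j ≡ p j +V z
      p'-at = cong (λ c → p j +V (c · z)) (trans (isYes≗does (j ≟ j)) (dec-true (j ≟ j) refl))
      moved : ∀ l → l ≢ j → Refl (p' l +V p' j)
      moved l l≢j = subst Refl (trans (+V-assoc (p l) (p j) z) (sym (cong₂ _+V_ (p'-off l l≢j) p'-at)))
                      (shift-edge z⊥ i j l j i≢j l≢j R)
      frame' : Frame p'
      frame' k l k≢l = by-cases (k ≟ j) (l ≟ j)
        where
        by-cases : Dec (k ≡ j) → Dec (l ≡ j) → Refl (p' k +V p' l)
        by-cases (yes refl) (yes refl) = contradiction refl k≢l
        by-cases (yes refl) (no l≢j)   = subst Refl (+V-comm (p' l) (p' k)) (moved l l≢j)
        by-cases (no k≢j)   (yes refl) = moved k k≢j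
        by-cases (no k≢j)   (no l≢j)   =
          subst Refl (sym (cong₂ _+V_ (p'-off k k≢j) (p'-off l l≢j))) (frame k l k≢l)
      -- The point adjoined is `p' i +V (r i j +V z')`, that is `p j +V z'`. For l other than j the
      -- pairing comes from the common endpoint i; for l = j only `b z z'` survives.
      sees : ∀ l → l ≢ i → b (r i j +V z') (p' i +V p' l) ≡ true
      sees l l≢i = by-cases (l ≟ j)
        where
        by-cases : Dec (l ≡ j) → b (r i j +V z') (p' i +V p' l) ≡ true
        by-cases (yes refl) = trans
          (cong (b _) (trans (cong₂ _+V_ (p'-off i i≢j) p'-at) (sym (+V-assoc (p i) (p j) z))))
          (plusˡ (plusʳ (b-self (r i j)) (flip-b (z⊥ i j))) (plusʳ (z'⊥ i j) (flip-b zz')))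
        by-cases (no l≢j) = trans
          (cong (b _) (cong₂ _+V_ (p'-off i i≢j) (p'-off l l≢j)))
          (plusˡ (trans (cong (λ x → b x (r i l)) (r-comm i j)) (meet j i l (i≢j ∘ sym) (l≢j ∘ sym) (l≢i ∘ sym)))
                 (z'⊥ i l))

  -- Consecutive sums of the six points form a path of five roots, and `a` meets only the middle
  -- one, where the two colour classes join.
  E₆-from-frame : ∀ {P : Fin 6 → V n} → Frame P → ∀ {a} → Refl a → ∀ d →
                  (∀ i → b a (P i) ≡ lookup (halves d) i) → E₆-Roots
  E₆-from-frame {P} frame {a} Ra d colour = record { e = e ; e-Refl = e-Refl ; gram = gram }
    where
    e : Fin 6 → V n
    e zero    = a
    e (suc i) = P (inject₁ i) +V P (suc i)
    inject₁≢suc : ∀ i → inject₁ {5} i ≢ suc i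
    inject₁≢suc = from-yes (all? λ i → ¬? (inject₁ {5} i ≟ suc i))
    e-Refl : ∀ i → Refl (e i)
    e-Refl zero    = Ra
    e-Refl (suc i) = frame (inject₁ i) (suc i) (inject₁≢suc i)
    gram : ∀ i j → b (e i) (e j) ≡ E₆-adj i j
    gram zero    zero    = b-self a
    gram zero    (suc i) = trans (plusʳ (colour (inject₁ i)) (colour (suc i))) (colour-change d i)
    gram (suc i) zero    = trans (flip-b (gram zero (suc i))) (adj-sym E₆ zero (suc i))
    gram (suc i) (suc j) = trans (b-r frame (inject₁ i) (suc i) (inject₁ j) (suc j)) (path-gram i j)

  -- Colourings of a frame by a root

  Enlargeable : ℕ → Set
  Enlargeable m = (∃[ p' ] Frame {suc m} p') ⊎ E₆-Roots

  module _ {m : ℕ} {p : Fin m → V n} (frame : Frame p) where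

    -- Paired with sums of points, `a` cannot be told from the edge `p i +V p j`.
    Twin : V n → Set
    Twin a = ∃₂ λ i j → i ≢ j × Orthogonal p (a +V (p i +V p j))

    -- A root a splits the points into two classes according to b a (p i): if one of them is
    -- a singleton the frame grows, and if both have three members there is an E₆.
    classify : ∀ {a} → Refl a → Enlargeable m ⊎ (Orthogonal p a ⊎ Twin a)
    classify {a} Ra = go (count colour true) (count colour false)
      where
      colour : Fin m → Bool
      colour i = b a (p i)
      two-points : ∀ d i j → i ≢ j → colour i ≡ d → colour j ≡ d →
                   (∀ k → k ≢ i → k ≢ j → colour k ≡ not d) → Twin a
      -- Up to the constant `not d` the colouring is the indicator of {i, j}; the constant cancels
      -- on a sum of two points and the rest is `incidence`.
      two-points d i j i≢j ci cj rest = i , j , i≢j , λ k l → trans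
        (plusˡ (plusʳ (c≡ k) (c≡ l)) (b-r frame i j k l))
        (truth-table 5 (λ x y z w d → (((x xor z) xor d) xor ((y xor w) xor d)) xor ((x xor y) xor (z xor w)))
                       (λ _ _ _ _ _ → false) refl (δ i k) (δ i l) (δ j k) (δ j l) (not d))
        where
        c≡ : ∀ k → colour k ≡ (δ i k xor δ j k) xor not d
        c≡ k with i ≟ k | j ≟ k
        ... | yes refl | yes refl = contradiction refl i≢j
        ... | yes refl | no _     = trans ci (truth-table 1 (λ d → d) (λ d → not (not d)) refl d)
        ... | no _     | yes refl = trans cj (truth-table 1 (λ d → d) (λ d → not (not d)) refl d)
        ... | no i≢k   | no j≢k   = rest k (i≢k ∘ sym) (j≢k ∘ sym)
      go : Count colour true → Count colour false → Enlargeable m ⊎ (Orthogonal p a ⊎ Twin a)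
      go (none c) _ = inj₂ (inj₁ λ i j → plusʳ (c i) (c j))
      go _ (none c) = inj₂ (inj₁ λ i j → plusʳ (c i) (c j))
      go (one i ci rest) _ = inj₁ (inj₁ (_ , extend-frame frame i Ra λ j j≢i → plusʳ ci (rest j j≢i)))
      go _ (one i ci rest) = inj₁ (inj₁ (_ , extend-frame frame i Ra λ j j≢i → plusʳ ci (rest j j≢i)))
      go (two i j i≢j ci cj rest) _ = inj₂ (inj₂ (two-points true i j i≢j ci cj rest))
      go _ (two i j i≢j ci cj rest) = inj₂ (inj₂ (two-points false i j i≢j ci cj rest))
      go (three i j k ij ik jk ci cj ck) (three i' j' k' ij' ik' jk' ci' cj' ck') =
        inj₁ (inj₂ (E₆-from-frame {p ∘ lookup xs} (λ s t s≢t → frame _ _ (s≢t ∘ lookup-injective distinct s t))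
                      Ra true λ { 0F → ci ; 1F → cj ; 2F → ck ; 3F → ci' ; 4F → cj' ; 5F → ck' }))
        where
        xs : Vec (Fin m) 6
        xs = i ∷ j ∷ k ∷ i' ∷ j' ∷ k' ∷ []
        _#_ : ∀ {x y} → colour x ≡ true → colour y ≡ false → x ≢ y
        (cx # cy) refl = true≢false cx cy
        distinct : Unique xs
        distinct = (ij ∷ ik ∷ ci # ci' ∷ ci # cj' ∷ ci # ck' ∷ [])
                 ∷ (jk ∷ cj # ci' ∷ cj # cj' ∷ cj # ck' ∷ [])
                 ∷ (ck # ci' ∷ ck # cj' ∷ ck # ck' ∷ [])
                 ∷ (ij' ∷ ik' ∷ []) ∷ (jk' ∷ []) ∷ [] ∷ []

  -- Either a line graph or an E₆ diagram

  module LineGraphOrE₆ (Γ : Graph k) (b-α : ∀ s t → b (α s) (α t) ≡ adj Γ s t)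
    (α-injective : ∀ s t → α s ≡ α t → s ≡ t) (connected : Connected Γ) where

    Labelled : ∀ {m} → (Fin m → V n) → Fin k → Set
    Labelled p s = ∃₂ λ i j → i < j × α s ≡ p i +V p j

    labelled? : ∀ {m} (p : Fin m → V n) s → Dec (Labelled p s)
    labelled? p s = any? λ i → any? λ j → i <? j ×-dec ≡-dec Bool._≟_ (α s) (p i +V p j)

    module _ {m : ℕ} {p : Fin m → V n} (frame : Frame p) where

      -- Each vertex is the sum of the endpoints of its label, so `b-r` turns adjacency into sharing
      -- an endpoint. `G` has the labels as its edges.
      line-graph : (∀ s → Labelled p s) → IsLineGraph Γ
      line-graph label = m , G , e , (λ s → e-< s , to _ _ (s , inj₁ refl)) , e-injective , e-surjective , λ s t → adj⇒share s t , share⇒adj s t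
        where
        e : Fin k → Fin m × Fin m
        e s = proj₁ (label s) , proj₁ (proj₂ (label s))
        e-< : ∀ s → proj₁ (e s) < proj₂ (e s)
        e-< s = proj₁ (proj₂ (proj₂ (label s)))
        e-α : ∀ s → α s ≡ p (proj₁ (e s)) +V p (proj₂ (e s))
        e-α s = proj₂ (proj₂ (proj₂ (label s)))
        Edge : Fin m → Fin m → Set
        Edge i j = ∃[ s ] (e s ≡ (i , j) ⊎ e s ≡ (j , i))
        edge? : ∀ i j → Dec (Edge i j)
        edge? i j = any? λ s → Prod.≡-dec _≟_ _≟_ (e s) (i , j) ⊎-dec Prod.≡-dec _≟_ _≟_ (e s) (j , i)
        to : ∀ i j → Edge i j → ⌊ edge? i j ⌋ ≡ true
        to i j E = trans (isYes≗does (edge? i j)) (dec-true (edge? i j) E)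
        from : ∀ i j → ⌊ edge? i j ⌋ ≡ true → Edge i j
        from i j eq with edge? i j
        ... | yes E = E
        G : Graph m
        G = record
          { adj     = λ i j → ⌊ edge? i j ⌋
          ; adj-sym = λ i j → Bool.⇔→≡ {z = true} (mk⇔ (λ h → to j i (map₂ swap (from i j h)))
                                               (λ h → to i j (map₂ swap (from j i h))))
          ; irrefl  = λ i → ¬-not λ h → loop i (from i i h)
          }
          where
          loop : ∀ i → ¬ Edge i i
          loop i (s , E) = <-irrefl (trans (cong proj₁ E') (sym (cong proj₂ E'))) (e-< s)
            where E' = [ id , id ]′ E
        e-injective : ∀ s t → e s ≡ e t → s ≡ t
        e-injective s t eq = α-injective s t
          (trans (e-α s) (trans (cong (λ ij → p (proj₁ ij) +V p (proj₂ ij)) eq) (sym (e-α t))))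
        e-surjective : ∀ i j → i < j → ⌊ edge? i j ⌋ ≡ true → ∃[ s ] e s ≡ (i , j)
        e-surjective i j i<j h with from i j h
        ... | s , inj₁ E = s , E
        ... | s , inj₂ E = contradiction (subst (λ ij → proj₁ ij < proj₂ ij) E (e-< s)) (<-asym i<j)
        adj≡ : ∀ s t → adj Γ s t ≡ incidence (e s) (e t)
        adj≡ s t = trans (sym (b-α s t)) (trans (cong₂ b (e-α s) (e-α t)) (b-r frame _ _ _ _))
        adj⇒share : ∀ s t → adj Γ s t ≡ true → s ≢ t × ShareEndpoint (e s) (e t)
        adj⇒share s t h = (λ { refl → true≢false h (irrefl Γ s) })
                        , incident⇒share (e s) (e t) (trans (sym (adj≡ s t)) h)
        share⇒adj : ∀ s t → s ≢ t × ShareEndpoint (e s) (e t) → adj Γ s t ≡ true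
        share⇒adj s t (s≢t , share) = trans (adj≡ s t)
          (share⇒incident (e s) (e t) (e-< s) (e-< t) (s≢t ∘ e-injective s t) share)

      -- A vertex that pairs with the frame like an edge without being equal to it; the difference z
      -- is the room for another point.
      Defect : Set
      Defect = ∃[ t ] ∃₂ λ i j → i ≢ j × Orthogonal p (α t +V (p i +V p j)) × α t +V (p i +V p j) ≢ 0V

      module _ (kinds : ∀ s → Orthogonal p (α s) ⊎ Twin frame (α s)) where

        -- If the difference were 0, `α s` would be a sum of two points and so orthogonal to `α u`,
        -- against adjacency.
        edge-defect : ∀ {s u} → Twin frame (α s) → adj Γ s u ≡ true → Orthogonal p (α u) → Defect
        edge-defect {s} {u} (i , j , i≢j , z⊥) a u⊥ = s , i , j , i≢j , z⊥ , λ z≡0 →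
          true≢false (trans (b-α s u) a)
            (trans (cong (λ x → b x (α u)) (+V-cancel (α s) _ z≡0)) (flip-b (u⊥ i j)))

        -- Along the walk some twin is followed by an orthogonal vertex, unless the walk is empty
        -- and its one vertex is of both kinds.
        defect-on-walk : ∀ {s t} → Twin frame (α s) → Orthogonal p (α t) → Walk Γ s t →
                         Defect ⊎ Orthogonal p (α s)
        defect-on-walk tw o here = inj₂ o
        defect-on-walk tw o (step {u = u} a w) with kinds u
        ... | inj₁ u⊥ = inj₁ (edge-defect tw a u⊥)
        ... | inj₂ tu with defect-on-walk tu o w
        ...   | inj₁ d  = inj₁ d
        ...   | inj₂ u⊥ = inj₁ (edge-defect tw a u⊥)

        -- A twin without label has a nonzero difference. If s is orthogonal instead, nondegeneracy
        -- gives a vertex t that meets a sum of two points; t is then a twin, and connectedness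
        -- gives a walk from t to s.
        unlabelled-defect : ∀ {i j} → i ≢ j → ∀ s → ¬ Labelled p s → Defect
        unlabelled-defect {i₀} {j₀} i₀≢j₀ s ¬l with kinds s
        ... | inj₂ (i , j , i≢j , z⊥) = s , i , j , i≢j , z⊥ , λ z≡0 → ¬l (label (+V-cancel (α s) _ z≡0))
          where
          label : α s ≡ p i +V p j → Labelled p s
          label e with <-cmp i j
          ... | tri< i<j _ _ = i , j , i<j , e
          ... | tri≈ _ i≡j _ = contradiction i≡j i≢j
          ... | tri> _ _ j<i = j , i , j<i , trans e (+V-comm (p i) (p j))
        ... | inj₁ s⊥ with nonorthogonal _ (r≢0 frame i₀ j₀ i₀≢j₀)
        ...   | t , h with kinds t
        ...     | inj₁ t⊥ = contradiction (t⊥ i₀ j₀) (true≢false (flip-b h))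
        ...     | inj₂ tw with defect-on-walk tw s⊥ (connected t s)
        ...       | inj₁ d  = d
        ...       | inj₂ t⊥ = contradiction (t⊥ i₀ j₀) (true≢false (flip-b h))

        -- Nondegeneracy gives t with `b z (α t)` equal to 1. The second shift for `enlarge` is
        -- `z +V α t` if t is orthogonal to the frame, and otherwise the difference between `α t`
        -- and its twin edge.
        enlarge-defect : Defect → ∃[ p' ] Frame {suc m} p'
        enlarge-defect (s , i , j , i≢j , z⊥ , z≢0) with nonorthogonal _ z≢0
        ... | t , zt with kinds t
        ...   | inj₁ t⊥ = enlarge frame i j i≢j z⊥ (Orthogonal-+ {p = p} z⊥ t⊥) (plusʳ (b-self _) zt)
                  (subst Refl s≡ (Refl-α s))
                  (subst Refl (trans (cong (_+V α t) s≡) (+V-assoc _ _ _))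
                    (Refl-+ (Refl-α s) (Refl-α t)
                      (trans (cong (λ x → b x (α t)) s≡) (plusˡ (flip-b (t⊥ i j)) zt))))
          where
          s≡ : α s ≡ (p i +V p j) +V (α s +V (p i +V p j))
          s≡ = vsolve #0 (#1 ⊞ (#0 ⊞ #1)) refl (α s ∷ (p i +V p j) ∷ [])
        ...   | inj₂ (i' , j' , i'≢j' , z'⊥) = enlarge frame i j i≢j z⊥ z'⊥ (plusʳ zt (z⊥ i' j'))
                  (subst Refl (vsolve #0 (#1 ⊞ (#0 ⊞ #1)) refl (α s ∷ (p i +V p j) ∷ [])) (Refl-α s))
                  (shift-edge frame z'⊥ i' j' i j i'≢j' i≢j
                    (subst Refl (vsolve #0 (#1 ⊞ (#0 ⊞ #1)) refl (α t ∷ (p i' +V p j') ∷ [])) (Refl-α t)))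

      improve : ∀ {i j : Fin m} → i ≢ j → IsLineGraph Γ ⊎ Enlargeable m
      improve i≢j with choose (λ s → classify frame (Refl-α s))
      ... | inj₁ better = inj₂ better
      ... | inj₂ kinds with any? (λ s → ¬? (labelled? p s))
      ...   | yes (s , ¬l) = inj₂ (inj₁ (enlarge-defect kinds (unlabelled-defect kinds i≢j s ¬l)))
      ...   | no  all-l    = inj₁ (line-graph λ s → decidable-stable (labelled? p s) λ ¬l → all-l (s , ¬l))

    -- Points of a frame are distinct, so there are at most `2 ^ n` of them; `d` bounds the
    -- enlargements still possible.
    search : ∀ d {m} {p : Fin (2 + m) → V n} → Frame p → 2 ^ n ℕ.< d + (2 + m) → IsLineGraph Γ ⊎ E₆-Roots
    search zero {p = p} frame size with pigeonhole size (encode ∘ p)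
    ... | i , j , i<j , e = contradiction i<j (<-irrefl (p-injective frame i j (encode-injective _ _ e)))
    search (suc d) {m} frame size with improve frame {0F} {1F} (λ ())
    ... | inj₁ line                = inj₁ line
    ... | inj₂ (inj₂ roots)        = inj₂ roots
    ... | inj₂ (inj₁ (_ , bigger)) = search d bigger (subst (2 ^ n ℕ.<_) (sym (ℕ.+-suc d (2 + m))) size)

    line-graph-or-E₆ : Fin k → IsLineGraph Γ ⊎ E₆-Roots
    line-graph-or-E₆ s = search (2 ^ n) edge (ℕ.m<m+n (2 ^ n) (ℕ.s≤s ℕ.z≤n))
      where
      edge : Frame {2} (lookup (0V ∷ α s ∷ []))
      edge 0F 0F 0≢0 = contradiction refl 0≢0
      edge 0F 1F _   = subst Refl (sym (+V-identityˡ (α s))) (Refl-α s)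
      edge 1F 0F _   = subst Refl (sym (+V-identityʳ (α s))) (Refl-α s)
      edge 1F 1F 1≢1 = contradiction refl 1≢1

  -- The E₆ space U and its orthogonal complement

  module FromE₆ (roots : E₆-Roots) (Γ : Graph k) (b-α : ∀ s t → b (α s) (α t) ≡ adj Γ s t)
    (connected : Connected Γ)
    (span : ∀ (P : V n → Set) → P 0V → (∀ x y → P x → P y → P (x +V y)) → (∀ s → P (α s)) → ∀ x → P x)
    where
    open E₆-Roots roots

    -- U = ι (V 6) is nondegenerate, so every vector is ι u + z with z orthogonal to U.
    opaque
      ι : V 6 → V n
      ι u = lin u (tabulate e)

    opaque
      unfolding ι

      ι-0 : ι 0V ≡ 0V
      ι-0 = lin-0 (tabulate e)

      ι-+ : ∀ u v → ι (u +V v) ≡ ι u +V ι v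
      ι-+ u v = lin-+ u v (tabulate e)

      ι-basis : ∀ i → ι (basis i) ≡ e i
      ι-basis i = trans (lin-basis i (tabulate e)) (lookup∘tabulate e i)

    module E₆Form = QuadraticSpace b₆ q₆ b₆-sym b₆-+ˡ b₆-self q₆-+

    b-ι : ∀ u v → b (ι u) (ι v) ≡ b₆ u v
    b-ι u v = basis-induction (λ u → b (ι u) (ι v) ≡ b₆ u v)
      (trans (cong (λ x → b x (ι v)) ι-0) (trans (b-0ˡ _) (sym (E₆Form.b-0ˡ v))))
      (λ x y p r → trans (cong (λ t → b t (ι v)) (ι-+ x y)) (trans (plusˡ p r) (sym (b₆-+ˡ x y v))))
      (λ i → basis-induction (λ v → b (ι (basis i)) (ι v) ≡ b₆ (basis i) v)
        (trans (cong (b _) ι-0) (trans (b-0ʳ _) (sym (E₆Form.b-0ʳ (basis i)))))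
        (λ x y p r → trans (cong (b _) (ι-+ x y)) (trans (plusʳ p r) (sym (E₆Form.plusʳ {x} {y} {basis i} refl refl))))
        (λ j → trans (cong₂ b (ι-basis i) (ι-basis j)) (trans (gram i j) (sym (b₆-basis i j)))) v) u

    q-ι : ∀ u → q (ι u) ≡ q₆ u
    q-ι = basis-induction (λ u → q (ι u) ≡ q₆ u)
      (trans (cong q ι-0) (trans q-0 (sym E₆Form.q-0)))
      (λ x y p r → trans (cong q (ι-+ x y)) (trans (plus-q p r (b-ι x y)) (sym (q₆-+ x y))))
      (λ i → trans (cong q (ι-basis i)) (trans (proj₁ (e-Refl i)) (sym (q₆-basis i))))

    ⊥U : V n → Set
    ⊥U z = ∀ u → b z (ι u) ≡ false

    ⊥U-+ : ∀ {z z'} → ⊥U z → ⊥U z' → ⊥U (z +V z')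
    ⊥U-+ o o' u = plusˡ (o u) (o' u)

    opaque
      -- `E₆-dual` finds u whose pairings with U are those of x; the remainder `ι u +V x` is then
      -- orthogonal to U.
      decompose : ∀ x → ∃₂ λ u z → x ≡ ι u +V z × ⊥U z
      decompose x with E₆-dual (tabulate λ i → b x (e i))
      ... | u , dual = u , ι u +V x , vsolve #1 (#0 ⊞ (#0 ⊞ #1)) refl (ι u ∷ x ∷ []) ,
        basis-induction (λ v → b (ι u +V x) (ι v) ≡ false)
          (trans (cong (b _) ι-0) (b-0ʳ _))
          (λ v w p r → trans (cong (b _) (ι-+ v w)) (plusʳ p r))
          (λ i → trans (plusˡ (trans (b-ι u (basis i)) (trans (dual i) (lookup∘tabulate (λ i → b x (e i)) i)))
                              (cong (b x) (ι-basis i)))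
                       (Bool.xor-same (b x (e i))))

    b-decomposed : ∀ {u v z y} → ⊥U z → ⊥U y → b (ι u +V z) (ι v +V y) ≡ b₆ u v xor b z y
    b-decomposed {u} {v} {z} {y} z⊥ y⊥ = trans
      (plusˡ (plusʳ (b-ι u v) (flip-b (y⊥ u))) (plusʳ (z⊥ v) refl))
      (truth-table 2 (λ c d → (c xor false) xor (false xor d)) (λ c d → c xor d) refl (b₆ u v) (b z y))

    b-ιˡ : ∀ {u v y} → ⊥U y → b (ι u) (ι v +V y) ≡ b₆ u v
    b-ιˡ {u} {v} y⊥ = trans (plusʳ (b-ι u v) (flip-b (y⊥ u))) (Bool.xor-identityʳ _)

    q-decomposed : ∀ {u z} → ⊥U z → q (ι u +V z) ≡ q₆ u xor q z
    q-decomposed {u} z⊥ = trans (plus-q (q-ι u) refl (flip-b (z⊥ u))) (Bool.xor-identityʳ _)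

    ι+-interchange : ∀ u v z y → (ι u +V z) +V (ι v +V y) ≡ ι (u +V v) +V (z +V y)
    ι+-interchange u v z y = trans (+V-interchange (ι u) z (ι v) y) (cong (_+V (z +V y)) (sym (ι-+ u v)))

    -- Every vector with Q = 1 is a root

    U-Refl : ∀ u → q₆ u ≡ true → Refl (ι u)
    U-Refl u qu = go (E₆-generated u qu)
      where
      go : ∀ {u} → Generated u → Refl (ι u)
      go (simple i)          = subst Refl (sym (ι-basis i)) (e-Refl i)
      go (sum {u} {v} g h e) = subst Refl (sym (ι-+ u v)) (Refl-+ (go g) (go h) (trans (b-ι u v) e))

    -- For z orthogonal to U the last hypothesis says q (ι u + z) = 1.
    Good : V n → Set
    Good z = ∀ u → u ≢ 0V → q₆ u ≡ not (q z) → Refl (ι u +V z)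

    -- The root `ι (u +V v)` is not orthogonal to `ι u +V z`, and adding it exchanges u for v.
    replace-u : ∀ {z u v} → ⊥U z → b₆ u v ≡ true → q₆ u ≡ q₆ v → Refl (ι u +V z) → Refl (ι v +V z)
    replace-u {z} {u} {v} z⊥ uv quv R = subst Refl
      (trans (cong ((ι u +V z) +V_) (ι-+ u v))
             (vsolve ((#0 ⊞ #2) ⊞ (#0 ⊞ #1)) (#1 ⊞ #2) refl (ι u ∷ ι v ∷ z ∷ [])))
      (Refl-+ R (U-Refl (u +V v)
                  (trans (E₆Form.plus-q {u} {v} quv refl uv) (cong (_xor true) (Bool.xor-same (q₆ v)))))
        (flip-b (trans (b-ιˡ {u +V v} {u} z⊥) (trans (b₆-+ˡ u v u) (cong₂ _xor_ (b₆-self u) (E₆Form.flip-b {u} {v} uv))))))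

    -- A bridge with the value of u is orthogonal neither to u nor to the anchor, so two
    -- replacements suffice, in either direction.
    to-anchor : ∀ {z u} → ⊥U z → u ≢ 0V → (Refl (ι u +V z) → Refl (ι (anchor (q₆ u)) +V z))
                                       × (Refl (ι (anchor (q₆ u)) +V z) → Refl (ι u +V z))
    to-anchor {z} {u} z⊥ u≢0 with E₆-bridge u u≢0 (q₆ u) (q₆ u)
    ... | w , qw , wu , wx =
      (λ R → replace-u z⊥ wx (trans qw (sym qx)) (replace-u z⊥ (E₆Form.flip-b {w} {u} wu) (sym qw) R)) ,
      (λ R → replace-u z⊥ wu qw (replace-u z⊥ (E₆Form.flip-b {w} {anchor (q₆ u)} wx) (trans qx (sym qw)) R))
      where
      qx : q₆ (anchor (q₆ u)) ≡ q₆ u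
      qx = q₆-anchor (q₆ u)

    -- The value of z determines that of the U-part of every root in its coset, so all these U-parts
    -- are linked through one anchor.
    good-from-one : ∀ {z u} → ⊥U z → u ≢ 0V → Refl (ι u +V z) → Good z
    good-from-one {z} {u} z⊥ u≢0 R v v≢0 qv = proj₂ (to-anchor z⊥ v≢0)
      (subst (λ c → Refl (ι (anchor c) +V z)) (trans qu (sym qv)) (proj₁ (to-anchor z⊥ u≢0) R))
      where
      qu : q₆ u ≡ not (q z)
      qu = xor-true⇒not (trans (sym (q-decomposed z⊥)) (proj₁ R))

    good-0 : Good 0V
    good-0 u u≢0 qu = subst Refl (sym (+V-identityʳ (ι u))) (U-Refl u (trans qu (cong not q-0)))

    -- u is split into parts that complete z and y to roots. These two and their sum all have value
    -- 1, so the two are not orthogonal and the sum is a root.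
    good-+ : ∀ {z y} → ⊥U z → ⊥U y → Good z → Good y → Good (z +V y)
    good-+ {z} {y} z⊥ y⊥ gz gy u u≢0 qu with E₆-split u u≢0 (not (q z)) (not (q y))
    ... | v , v≢0 , v+u≢0 , qv , qvu = subst Refl sum≡
        (Refl-+ Rz Ry (trans (b≡q-defect _ _)
          (cong₂ _xor_ (cong₂ _xor_ (proj₁ Rz) (proj₁ Ry)) (trans (cong q sum≡) (trans (q-decomposed (⊥U-+ z⊥ y⊥))
            (trans (cong (_xor q (z +V y)) qu) (truth-table 1 (λ c → not c xor c) (λ _ → true) refl (q (z +V y)))))))))
      where
      Rz : Refl (ι v +V z)
      Rz = gz v v≢0 qv
      Ry : Refl (ι (v +V u) +V y)
      Ry = gy (v +V u) v+u≢0 qvu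
      sum≡ : (ι v +V z) +V (ι (v +V u) +V y) ≡ ι u +V (z +V y)
      sum≡ = trans (ι+-interchange v (v +V u) z y)
        (cong (λ t → ι t +V (z +V y)) (vsolve (#0 ⊞ (#0 ⊞ #1)) #1 refl (v ∷ u ∷ [])))

    GoodVector : V n → Set
    GoodVector x = ∃₂ λ u z → x ≡ ι u +V z × ⊥U z × Good z

    -- If `α s` has a nonzero U-part, it is itself the one root needed. Otherwise `α s` is y in U⊥
    -- and meets z; adding it to a root over z gives one over `z +V y`, and y is the sum of the good
    -- vectors z and `z +V y`.
    good-neighbour : ∀ {x} s → GoodVector x → b x (α s) ≡ true → GoodVector (α s)
    good-neighbour {x} s (u , z , refl , z⊥ , gz) xs with decompose (α s)
    ... | v , y , αs≡ , y⊥ with v ≟V 0V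
    ...   | no  v≢0  = v , y , αs≡ , y⊥ , good-from-one y⊥ v≢0 (subst Refl αs≡ (Refl-α s))
    ...   | yes refl = 0V , y , αs≡ , y⊥ ,
        subst Good (vsolve (#0 ⊞ (#0 ⊞ #1)) #1 refl (z ∷ y ∷ [])) (good-+ z⊥ (⊥U-+ z⊥ y⊥) gz good-z+y)
      where
      αs≡y : α s ≡ y
      αs≡y = trans αs≡ (trans (cong (_+V y) ι-0) (+V-identityˡ y))
      zy : b z y ≡ true
      zy = trans (sym (plusˡ (flip-b (y⊥ u)) refl)) (trans (cong (b _) (sym αs≡y)) xs)
      w : V 6
      w = anchor (not (q z))
      Rw : Refl (ι w +V z)
      Rw = gz w (anchor≢0 (not (q z))) (q₆-anchor (not (q z)))
      good-z+y : Good (z +V y)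
      good-z+y = good-from-one (⊥U-+ z⊥ y⊥) (anchor≢0 (not (q z)))
        (subst Refl (+V-assoc (ι w) z y)
          (Refl-+ Rw (subst Refl αs≡y (Refl-α s)) (plusˡ (flip-b (y⊥ w)) zy)))

    good-walk : ∀ {s t} → GoodVector (α s) → Walk Γ s t → GoodVector (α t)
    good-walk g here                     = g
    good-walk {s} g (step {u = u} a w) = good-walk (good-neighbour u g (trans (b-α s u) a)) w

    -- `e 0F` lies in U, so its U⊥-part 0 is good; it meets some vertex, and connectedness carries
    -- goodness to all others.
    good-α : ∀ t → GoodVector (α t)
    good-α t with nonorthogonal (e 0F) (q-true⇒≢0 (proj₁ (e-Refl 0F)))
    ... | s , h = good-walk (good-neighbour s (basis 0F , 0V , trans (sym (ι-basis 0F)) (sym (+V-identityʳ _)) ,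
                                               (λ u → b-0ˡ (ι u)) , good-0) h) (connected s t)

    good-vector : ∀ x → GoodVector x
    good-vector = span GoodVector
      (0V , 0V , sym (trans (+V-identityʳ (ι 0V)) ι-0) , (λ u → b-0ˡ (ι u)) , good-0)
      (λ { _ _ (u , z , refl , z⊥ , gz) (v , y , refl , y⊥ , gy) →
           u +V v , z +V y , ι+-interchange u v z y , ⊥U-+ z⊥ y⊥ , good-+ z⊥ y⊥ gz gy })
      good-α

    -- Goodness settles a nonzero U-part. For x in U⊥ choose a vertex meeting x, with U⊥-part y;
    -- then x is the sum of a root over y and one over `x +V y` with the same U-part, and these two
    -- are not orthogonal.
    all-Refl : ∀ x → q x ≡ true → Refl x
    all-Refl x qx with good-vector x
    ... | u , z , x≡ , z⊥ , gz with u ≟V 0V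
    ...   | no u≢0 = subst Refl (sym x≡) (gz u u≢0
              (xor-true⇒not (trans (sym (q-decomposed z⊥)) (trans (cong q (sym x≡)) qx))))
    ...   | yes refl with nonorthogonal x (q-true⇒≢0 qx)
    ...     | t , xt with good-vector (α t)
    ...       | v , y , t≡ , y⊥ , gy = subst Refl x≡sum
                (Refl-+ (gy w (anchor≢0 (not (q y))) (q₆-anchor (not (q y))))
                        (good-+ z⊥ y⊥ gz gy w (anchor≢0 (not (q y)))
                          (trans (q₆-anchor (not (q y))) (cong not (sym qzy))))
                        (trans (b-decomposed {w} {w} y⊥ (⊥U-+ z⊥ y⊥))
                               (cong₂ _xor_ (b₆-self w) (plusʳ (flip-b zy) (b-self y)))))
      where
      w : V 6
      w = anchor (not (q y))
      x≡z : x ≡ z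
      x≡z = trans x≡ (trans (cong (_+V z) ι-0) (+V-identityˡ z))
      zy : b z y ≡ true
      zy = trans (sym (trans (cong (b z) t≡) (plusʳ (z⊥ v) refl))) (trans (cong (λ c → b c (α t)) (sym x≡z)) xt)
      qzy : q (z +V y) ≡ q y
      qzy = trans (plus-q (trans (cong q (sym x≡z)) qx) refl zy)
                  (truth-table 1 (λ c → (true xor c) xor true) (λ c → c) refl (q y))
      x≡sum : (ι w +V y) +V (ι w +V (z +V y)) ≡ x
      x≡sum = trans (vsolve ((#0 ⊞ #1) ⊞ (#0 ⊞ (#2 ⊞ #1))) #2 refl (ι w ∷ y ∷ z ∷ [])) (sym x≡z)

    -- Moving a vector by reflections that fix a given list

    Perp : List (V n) → V n → Set
    Perp xs w = All (λ ξ → b ξ w ≡ false) xs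

    Perp-+ : ∀ {xs v w} → Perp xs v → Perp xs w → Perp xs (v +V w)
    Perp-+ vs ws = All.zipWith (λ (p , r) → plusʳ p r) (vs , ws)

    Moves : List (V n) → V n → V n → Set
    Moves xs y x = ∃[ w ] (Φ w y ≡ x × All (λ ξ → Φ w ξ ≡ ξ) xs)

    moves-trans : ∀ {xs x y z} → Moves xs x y → Moves xs y z → Moves xs x z
    moves-trans {x = x} (w , e₁ , f₁) (v , e₂ , f₂) = v ++ w ,
      trans (Φ-++ v w x) (trans (cong (Φ v) e₁) e₂) ,
      All.zipWith (λ {ξ} (p , r) → trans (Φ-++ v w ξ) (trans (cong (Φ v) p) r)) (f₁ , f₂)

    reflect : ∀ {xs y v} → q v ≡ true → Perp xs v → b y v ≡ true → Moves xs y (y +V v)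
    reflect {y = y} {v} qv vs yv with proj₂ (all-Refl v qv)
    ... | w , w≗T = w , trans (w≗T y) (T-moves yv) , All.map (λ {ξ} p → trans (w≗T ξ) (T-fixes p)) vs

    -- The reflecting vector is `y +V x`, which has value 1 under these hypotheses.
    one-reflection : ∀ {xs y x} → q y ≡ q x → Perp xs (y +V x) → b y x ≡ true → Moves xs y x
    one-reflection {xs} {y} {x} qyx ps yx = subst (Moves xs y) (vsolve (#0 ⊞ (#0 ⊞ #1)) #1 refl (y ∷ x ∷ []))
      (reflect (trans (plus-q qyx refl yx) (cong (_xor true) (Bool.xor-same (q x)))) ps (plusʳ (b-self y) yx))

    -- If y and x are orthogonal, reflecting in w first turns y into `y +V w`, which meets x.
    two-reflections : ∀ {xs y x w} → q y ≡ q x → Perp xs (y +V x) →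
                      q w ≡ true → Perp xs w → b w y ≡ true → b w x ≡ true → Moves xs y x
    two-reflections {xs} {y} {x} {w} qyx ps qw ws wy wx with b y x in yx
    ... | true  = one-reflection qyx ps yx
    ... | false = moves-trans (reflect qw ws (flip-b wy)) (one-reflection
        (trans (plus-q qyx qw (flip-b wy)) (truth-table 1 (λ c → (c xor true) xor true) (λ c → c) refl (q x)))
        (subst (Perp xs) (vsolve ((#0 ⊞ #1) ⊞ #2) ((#0 ⊞ #2) ⊞ #1) refl (y ∷ x ∷ w ∷ [])) (Perp-+ ps ws))
        (plusˡ yx wx))

    OutsideU⊥ : V n → Set
    OutsideU⊥ y = ∃₂ λ u z → y ≡ ι u +V z × ⊥U z × u ≢ 0V

    ι-Perp : ∀ {xs} → All ⊥U xs → ∀ u → Perp xs (ι u)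
    ι-Perp xs⊥ u = All.map (λ ξ⊥ → ξ⊥ u) xs⊥

    -- For y in U⊥ only the U⊥-part of w meets y. An anchor replaces the U-part of w to reach value
    -- 1; reflecting then gives y that anchor as U-part, and `xs`, lying in U⊥, does not notice the
    -- change.
    leave-U⊥ : ∀ {xs y w} → All ⊥U xs → Perp xs w → b w y ≡ true →
               ∃[ y' ] (Moves xs y y' × OutsideU⊥ y' × q y' ≡ q y × Perp xs (y +V y'))
    leave-U⊥ {xs} {y} {w} xs⊥ ws wy with decompose y
    ... | u , z , y≡ , z⊥ with u ≟V 0V
    ...   | no u≢0 = y , ([] , refl , All.map (λ _ → refl) xs⊥) , (u , z , y≡ , z⊥ , u≢0) , refl ,
              subst (Perp xs) (sym (+V-self y)) (All.map (λ _ → b-0ʳ _) xs⊥)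
    ...   | yes u≡0 with decompose w
    ...     | v , t , w≡ , t⊥ = y +V w' , reflect qw' ws' yw' ,
                (a , z +V t , trans (cong (_+V w') y≡z) (vsolve (#0 ⊞ (#1 ⊞ #2)) (#1 ⊞ (#0 ⊞ #2)) refl (z ∷ ι a ∷ t ∷ [])) ,
                 ⊥U-+ z⊥ t⊥ , anchor≢0 (not (q t))) ,
                trans (plus-q refl qw' yw') (truth-table 1 (λ c → (c xor true) xor true) (λ c → c) refl (q y)) ,
                subst (Perp xs) (vsolve #1 (#0 ⊞ (#0 ⊞ #1)) refl (y ∷ w' ∷ [])) ws'
      where
      a : V 6
      a = anchor (not (q t))
      w' : V n
      w' = ι a +V t
      y≡z : y ≡ z
      y≡z = trans y≡ (trans (cong (λ c → ι c +V z) u≡0) (trans (cong (_+V z) ι-0) (+V-identityˡ z)))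
      qw' : q w' ≡ true
      qw' = trans (q-decomposed t⊥) (trans (cong (_xor q t) (q₆-anchor (not (q t))))
              (truth-table 1 (λ c → not c xor c) (λ _ → true) refl (q t)))
      t≡ : t ≡ w +V ι v
      t≡ = trans (vsolve #1 ((#0 ⊞ #1) ⊞ #0) refl (ι v ∷ t ∷ [])) (cong (_+V ι v) (sym w≡))
      ws' : Perp xs w'
      ws' = Perp-+ (ι-Perp xs⊥ a) (subst (Perp xs) (sym t≡) (Perp-+ ws (ι-Perp xs⊥ v)))
      yw' : b y w' ≡ true
      yw' = trans (cong (λ c → b c w') y≡z) (plusʳ (z⊥ a) (trans (cong (b z) t≡)
              (plusʳ (trans (cong (λ c → b c w) (sym y≡z)) (flip-b wy)) (z⊥ v))))

    -- A vector of U added to w adjusts q w and b w y without changing b w x.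
    move-to-U⊥ : ∀ {xs y x w w'} → All ⊥U xs → ⊥U x → q y ≡ q x → Perp xs (y +V x) →
                 Perp xs w → b w x ≡ true → Perp xs w' → b w' y ≡ true → Moves xs y x
    move-to-U⊥ {xs} {y} {x} {w} xs⊥ x⊥ qyx ps ws wx ws' w'y with leave-U⊥ xs⊥ ws' w'y
    ... | y' , moves , (u , z , y'≡ , z⊥ , u≢0) , qy' , ps' with decompose w
    ...   | v , t , w≡ , t⊥ with E₆-solve u u≢0 (not (b t z)) (not (q t))
    ...     | a , au , qa = moves-trans moves (two-reflections (trans qy' qyx)
                (subst (Perp xs) (vsolve ((#0 ⊞ #1) ⊞ (#0 ⊞ #2)) (#1 ⊞ #2) refl (y ∷ y' ∷ x ∷ [])) (Perp-+ ps' ps))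
                qc (Perp-+ (ι-Perp xs⊥ a) (subst (Perp xs) (sym t≡) (Perp-+ ws (ι-Perp xs⊥ v)))) cy cx)
      where
      c : V n
      c = ι a +V t
      t≡ : t ≡ w +V ι v
      t≡ = trans (vsolve #1 ((#0 ⊞ #1) ⊞ #0) refl (ι v ∷ t ∷ [])) (cong (_+V ι v) (sym w≡))
      qc : q c ≡ true
      qc = trans (q-decomposed t⊥) (trans (cong (_xor q t) qa) (truth-table 1 (λ c → not c xor c) (λ _ → true) refl (q t)))
      cy : b c y' ≡ true
      cy = trans (cong (b c) y'≡) (trans (b-decomposed t⊥ z⊥) (trans (cong (_xor b t z) au)
             (truth-table 1 (λ c → not c xor c) (λ _ → true) refl (b t z))))
      cx : b c x ≡ true
      cx = plusˡ (flip-b (x⊥ a)) (trans (cong (λ d → b d x) t≡) (plusˡ wx (flip-b (x⊥ v))))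

    -- Once y has a nonzero U-part, a bridge from that part to the anchor lies in U and meets both
    -- vectors, so two reflections finish.
    move-to-anchor : ∀ y → y ≢ 0V → Moves [] y (ι (anchor (q y)))
    move-to-anchor y y≢0 with nonorthogonal y y≢0
    ... | s , ys with leave-U⊥ [] [] (flip-b ys)
    ...   | y' , moves , (u , z , y'≡ , z⊥ , u≢0) , qy' , _ with E₆-bridge u u≢0 (q y) true
    ...     | w , qw , wu , wx = moves-trans moves
                (two-reflections (trans qy' (sym (trans (q-ι _) (q₆-anchor (q y))))) [] (trans (q-ι w) qw) []
                  (trans (cong (b (ι w)) y'≡) (trans (b-ιˡ z⊥) wu)) (trans (b-ι w _) wx))

    -- If f separates x from `ys`, g separates `x +V y` from `ys`, and both meet y, then their sum
    -- is orthogonal to y and still meets x.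
    span-or-separated : ∀ xs x → InSpan xs x ⊎ ∃[ w ] (Perp xs w × b w x ≡ true)
    span-or-separated [] x with x ≟V 0V
    ... | yes x≡0 = inj₁ x≡0
    ... | no  x≢0 with nonorthogonal x x≢0
    ...   | s , xs = inj₂ (α s , [] , flip-b xs)
    span-or-separated (y ∷ ys) x with span-or-separated ys x
    ... | inj₁ s = inj₁ (inj₁ s)
    ... | inj₂ (f , fys , fx) with b f y in fy
    ...   | false = inj₂ (f , flip-b fy ∷ fys , fx)
    ...   | true with span-or-separated ys (x +V y)
    ...     | inj₁ s = inj₁ (inj₂ s)
    ...     | inj₂ (g , gys , gxy) with b g y in gy
    ...       | false = inj₂ (g , flip-b gy ∷ gys ,
                  trans (cong (b g) (vsolve #0 ((#0 ⊞ #1) ⊞ #1) refl (x ∷ y ∷ []))) (plusʳ gxy gy))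
    ...       | true  = inj₂ (f +V g , flip-b (plusˡ fy gy) ∷ Perp-+ fys gys ,
                  plusˡ fx (trans (cong (b g) (vsolve #0 ((#0 ⊞ #1) ⊞ #1) refl (x ∷ y ∷ []))) (plusʳ gxy gy)))

    -- Undoing an isometry by reflections

    Fixes : (V n → V n) → List (V n) → Set
    Fixes σ = All (λ ξ → σ ξ ≡ ξ)

    span-fixed : ∀ {m} {σ : V m → V n} {τ : V m → V n} → (∀ x y → σ (x +V y) ≡ σ x +V σ y) →
                 (∀ x y → τ (x +V y) ≡ τ x +V τ y) → σ 0V ≡ τ 0V → ∀ {xs} → All (λ ξ → σ ξ ≡ τ ξ) xs →
                 ∀ {x} → InSpan xs x → σ x ≡ τ x
    span-fixed σ+ τ+ e0 []       refl     = e0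
    span-fixed σ+ τ+ e0 (p ∷ ps) (inj₁ s) = span-fixed σ+ τ+ e0 ps s
    span-fixed {σ = σ} {τ} σ+ τ+ e0 {y ∷ _} (p ∷ ps) {x} (inj₂ s) = begin
      σ x               ≡⟨ cong σ x≡ ⟩
      σ ((x +V y) +V y) ≡⟨ σ+ _ _ ⟩
      σ (x +V y) +V σ y ≡⟨ cong₂ _+V_ (span-fixed σ+ τ+ e0 ps s) p ⟩
      τ (x +V y) +V τ y ≡⟨ sym (τ+ _ _) ⟩
      τ ((x +V y) +V y) ≡⟨ cong τ (sym x≡) ⟩
      τ x               ∎
      where
      open ≡-Reasoning
      x≡ : x ≡ (x +V y) +V y
      x≡ = vsolve #0 ((#0 ⊞ #1) ⊞ #1) refl (x ∷ y ∷ [])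

    FixableTo : (V n → V n) → List (V n) → Set
    FixableTo σ xs = ∃[ w ] Fixes (Φ w ∘ σ) xs

    fix-next : ∀ {σ xs x} w → Fixes (Φ w ∘ σ) xs → Moves xs (Φ w (σ x)) x → FixableTo σ (x ∷ xs)
    fix-next {σ} {xs} {x} w fixed (v , vx , vs) = v ++ w ,
      trans (Φ-++ v w (σ x)) vx ∷
      All.zipWith (λ {ξ} (p , r) → trans (Φ-++ v w (σ ξ)) (trans (cong (Φ v) p) r)) (fixed , vs)

    -- A fixed vector pairs equally with x and `σ x`, so a reflection in `σ x +V x` leaves it fixed.
    isometry-Perp : ∀ {σ xs} x → Isometry σ → Fixes σ xs → Perp xs (σ x +V x)
    isometry-Perp {σ} x iso = All.map λ {ξ} fix → trans
      (plusʳ (trans (cong (λ c → b c (σ x)) (sym fix)) (b-preserved iso ξ x)) refl) (Bool.xor-same (b ξ x))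

    -- A vector in the span of the fixed ones is fixed too. Otherwise a separating v meets x, its
    -- image under the current isometry meets the image of x, and both are orthogonal to all fixed
    -- vectors, as `move-to-U⊥` demands.
    fix-in-U⊥ : ∀ {σ} → Isometry σ → ∀ xs → All ⊥U xs → FixableTo σ xs
    fix-in-U⊥ iso []       []          = [] , []
    fix-in-U⊥ {σ} iso (x ∷ xs) (x⊥ ∷ xs⊥) with fix-in-U⊥ iso xs xs⊥
    ... | w , fixed with span-or-separated xs x
    ...   | inj₁ s = w , span-fixed (additive τ-iso) (λ _ _ → refl) (zero-preserved τ-iso) fixed s ∷ fixed
      where τ-iso = ∘-isometry (Φ-isometry w) iso
    ...   | inj₂ (v , vs , vx) = fix-next w fixed (move-to-U⊥ xs⊥ x⊥ (q-preserved τ-iso x)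
              (isometry-Perp x τ-iso fixed) vs vx
              (All.zipWith (λ {ξ} (p , r) → trans (cong (λ c → b c (τ v)) (sym r)) (trans (b-preserved τ-iso ξ v) p)) (vs , fixed))
              (trans (b-preserved τ-iso v x) vx))
      where
      τ = Φ w ∘ σ
      τ-iso = ∘-isometry (Φ-isometry w) iso

    U-part : Fin k → V 6
    U-part s = proj₁ (decompose (α s))

    U⊥-part : Fin k → V n
    U⊥-part s = proj₁ (proj₂ (decompose (α s)))

    α-decomposed : ∀ s → α s ≡ ι (U-part s) +V U⊥-part s
    α-decomposed s = proj₁ (proj₂ (proj₂ (decompose (α s))))

    U⊥-part-⊥U : ∀ s → ⊥U (U⊥-part s)
    U⊥-part-⊥U s = proj₂ (proj₂ (proj₂ (decompose (α s))))

    U⊥-spanning : List (V n)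
    U⊥-spanning = List.tabulate U⊥-part

    U⊥-spanning-⊥U : All ⊥U U⊥-spanning
    U⊥-spanning-⊥U = All.tabulate⁺ U⊥-part-⊥U

    -- The image of U stays orthogonal to the fixed U⊥-parts of the vertices. Its own U⊥-part is
    -- orthogonal to these and to U, hence to every vertex, and vanishes.
    preserves-U : ∀ {σ} → Isometry σ → Fixes σ U⊥-spanning → ∀ u → ∃[ v ] σ (ι u) ≡ ι v
    preserves-U {σ} iso fixed u with decompose (σ (ι u))
    ... | v , z , σu≡ , z⊥ = v , trans σu≡ (trans (cong (ι v +V_) (nondegenerate z orthogonal)) (+V-identityʳ (ι v)))
      where
      orthogonal : ∀ s → b z (α s) ≡ false
      orthogonal s = trans (cong (b z) (α-decomposed s)) (plusʳ (z⊥ (U-part s))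
        (trans (cong (λ c → b c y) (trans (vsolve #1 ((#0 ⊞ #1) ⊞ #0) refl (ι v ∷ z ∷ [])) (cong (_+V ι v) (sym σu≡))))
          (plusˡ (trans (cong (b (σ (ι u))) (sym (All.tabulate⁻ fixed s))) (trans (b-preserved iso (ι u) y) (flip-b (y⊥ u))))
                 (flip-b (y⊥ v)))))
        where
        y = U⊥-part s
        y⊥ = U⊥-part-⊥U s

    -- The next target is sent to some `ι c` in U, and c satisfies the hypotheses of `Stage`. The
    -- reflecting vectors it yields lie in U, so the vectors fixed in U⊥ stay fixed.
    fix-in-U : ∀ {σ} → Isometry σ → ∀ {ts} ts' → Stages ts ts' → FixableTo σ (map ι ts ++ U⊥-spanning) →
               ∃[ w ] (Fixes (Φ w ∘ σ) U⊥-spanning × All (λ t → Φ w (σ (ι t)) ≡ ι t) (ts' List.ʳ++ ts))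
    fix-in-U iso {ts} [] _ (w , fixed) =
      w , All.++⁻ʳ (map ι ts) fixed , All.map⁻ (All.++⁻ˡ (map ι ts) fixed)
    fix-in-U {σ} iso {ts} (t ∷ ts') (st , sts) (w , fixed) = fix-in-U iso {t ∷ ts} ts' sts (fix-next w fixed moves)
      where
      τ = Φ w ∘ σ
      τ-iso = ∘-isometry (Φ-isometry w) iso
      fixed-ts : All (λ x → τ (ι x) ≡ ι x) ts
      fixed-ts = All.map⁻ (All.++⁻ˡ (map ι ts) fixed)
      perp : ∀ {v} → All (λ x → b₆ v x ≡ false) ts → Perp (map ι ts ++ U⊥-spanning) (ι v)
      perp {v} vs = All.++⁺ (All.map⁺ (All.map (λ {x} p → flip-b (trans (b-ι v x) p)) vs)) (ι-Perp U⊥-spanning-⊥U v)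
      moves : Moves (map ι ts ++ U⊥-spanning) (τ (ι t)) (ι t)
      moves with preserves-U τ-iso (All.++⁻ʳ (map ι ts) fixed) t
      ... | c , τt≡ with st c (trans (sym (q-ι c)) (trans (cong q (sym τt≡)) (trans (q-preserved τ-iso (ι t)) (q-ι t))))
                          (All.map (λ {x} fix → trans (sym (b-ι c x)) (trans (cong₂ b (sym τt≡) (sym fix))
                                     (trans (b-preserved τ-iso (ι t) (ι x)) (b-ι t x)))) fixed-ts)
      ...   | inj₁ refl = [] , τt≡ , All.map (λ _ → refl) fixed
      ...   | inj₂ (inj₁ ct) = one-reflection (q-preserved τ-iso (ι t)) (isometry-Perp (ι t) τ-iso fixed)
                (trans (cong (λ d → b d (ι t)) τt≡) (trans (b-ι c t) ct))
      ...   | inj₂ (inj₂ (v , qv , vc , vt , vs)) =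
                two-reflections (q-preserved τ-iso (ι t)) (isometry-Perp (ι t) τ-iso fixed)
                  (trans (q-ι v) qv) (perp vs) (trans (cong (b (ι v)) τt≡) (trans (b-ι v c) vc)) (trans (b-ι v t) vt)

    -- Once `Φ w ∘ σ` fixes U and the U⊥-parts of all vertices it is the identity, so σ acts as the
    -- reversed word.
    isometry-in-G : ∀ {σ} → Isometry σ → InG σ
    isometry-in-G {σ} iso with fix-in-U iso targets E₆-stages (fix-in-U⊥ iso U⊥-spanning U⊥-spanning-⊥U)
    ... | w , fixed-U⊥ , fixed-targets = reverse w , λ x → trans (cong (Φ (reverse w)) (sym (τ≗id x))) (Φ-reverseˡ w (σ x))
      where
      τ = Φ w ∘ σ
      τ-iso = ∘-isometry (Φ-isometry w) iso
      fixed-U : ∀ u → τ (ι u) ≡ ι u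
      fixed-U u = span-fixed (λ x y → trans (cong τ (ι-+ x y)) (additive τ-iso (ι x) (ι y))) ι-+
        (trans (cong τ ι-0) (trans (zero-preserved τ-iso) (sym ι-0))) fixed-targets (targets-span u)
      τ≗id : τ ≗ id
      τ≗id = span (λ x → τ x ≡ x) (zero-preserved τ-iso)
        (λ x y p r → trans (additive τ-iso x y) (cong₂ _+V_ p r)) fixed-α
        where
        fixed-α : ∀ s → τ (α s) ≡ α s
        fixed-α s = trans (cong τ (α-decomposed s)) (trans (additive τ-iso (ι (U-part s)) (U⊥-part s))
          (trans (cong₂ _+V_ (fixed-U (U-part s)) (All.tabulate⁻ fixed-U⊥ s)) (sym (α-decomposed s))))

    move-between : ∀ {x y} → x ≢ 0V → y ≢ 0V → q x ≡ q y → ∃[ w ] Φ w x ≡ y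
    move-between {x} {y} x≢0 y≢0 qxy =
      let w , wx , _ = move-to-anchor x x≢0
          v , vy , _ = move-to-anchor y y≢0
      in Φ-connect w v (trans wx (cong (ι ∘ anchor) qxy)) vy

    q-attained : ∀ c → ∃[ x ] (q x ≡ c × x ≢ 0V)
    q-attained c with E₆-bridge (anchor c) (anchor≢0 c) c c
    ... | w , _ , wx , _ = ι (anchor c) , trans (q-ι _) (q₆-anchor c) , λ e →
      true≢false (trans (b-ι w (anchor c)) wx) (trans (cong (b (ι w)) e) (b-0ʳ (ι w)))

-- The empty graph is its own line graph, so a graph as in the theorem has a vertex from which the
-- search can start.
no-vertices⇒line-graph : (Γ : Graph 0) → IsLineGraph Γ
no-vertices⇒line-graph Γ = 0 , Γ , (λ ()) , (λ ()) , (λ ()) , (λ ()) , λ ()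

-- Transfer to configurations along θ

module Configurations {n : ℕ} (Γ : Graph n) (nondegenerate : NonDegenerate Γ) where

  module Form = QuadraticSpace (B Γ) (Q Γ) (B-sym Γ) (B-+ˡ Γ) (B-self Γ) (Q-+ Γ)

  nondegenerate-basis : ∀ x → (∀ s → B Γ x (basis s) ≡ false) → x ≡ 0V
  nondegenerate-basis x o = nondegenerate x (basis-induction (λ y → B Γ x y ≡ false)
    (Form.b-0ʳ x) (λ y z p r → Form.plusʳ {y} {z} {x} p r) o)

  open Reflections (B Γ) (Q Γ) (B-sym Γ) (B-+ˡ Γ) (B-self Γ) (Q-+ Γ)
    basis (Q-basis Γ) nondegenerate-basis public

  θ-+ : ∀ x y → θ Γ (x +V y) ≡ θ Γ x +V θ Γ y
  θ-+ x y = trans (sym (tabulate∘lookup _)) (trans (tabulate-cong λ t → begin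
      lookup (θ Γ (x +V y)) t                    ≡⟨ lookup∘tabulate _ t ⟩
      B Γ (x +V y) (basis t)                     ≡⟨ B-+ˡ Γ x y (basis t) ⟩
      B Γ x (basis t) xor B Γ y (basis t)
        ≡⟨ sym (cong₂ _xor_ (lookup∘tabulate (λ t → B Γ x (basis t)) t) (lookup∘tabulate (λ t → B Γ y (basis t)) t)) ⟩
      lookup (θ Γ x) t xor lookup (θ Γ y) t      ≡⟨ sym (lookup-zipWith _xor_ t (θ Γ x) (θ Γ y)) ⟩
      lookup (θ Γ x +V θ Γ y) t                  ∎) (tabulate∘lookup _))
    where open ≡-Reasoning

  θ-0 : θ Γ 0V ≡ 0V
  θ-0 = trans (cong (θ Γ) (sym (+V-self 0V))) (trans (θ-+ 0V 0V) (+V-self (θ Γ 0V)))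

  θ-kernel : ∀ x → θ Γ x ≡ 0V → x ≡ 0V
  θ-kernel x e = nondegenerate-basis x λ s →
    trans (sym (lookup∘tabulate (λ t → B Γ x (basis t)) s)) (trans (cong (λ f → lookup f s) e) (lookup-replicate s false))

  θ-injective : ∀ x y → θ Γ x ≡ θ Γ y → x ≡ y
  θ-injective x y e = +V-cancel x y (θ-kernel (x +V y) (trans (θ-+ x y) (trans (cong (_+V θ Γ y) e) (+V-self (θ Γ y)))))

  θ-surjective : ∀ f → ∃[ x ] θ Γ x ≡ f
  θ-surjective = injective⇒surjective (θ Γ) θ-injective

  -- `θ` sends `basis s` to the sum of the `f_t` over the neighbours t of s, and the coordinate of
  -- `θ Γ x` tested by the move is the pairing of x with `basis s`.
  κ-θ : ∀ s x → κ Γ s (θ Γ x) ≡ θ Γ (T (basis s) x)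
  κ-θ s x = trans
    (cong (θ Γ x +V_) (trans (cong (λ c → if c then tabulate (adj Γ s) else 0V) (lookup∘tabulate (λ t → B Γ x (basis t)) s))
                             (sym (θ-· (B Γ x (basis s))))))
    (sym (θ-+ x (B Γ x (basis s) · basis s)))
    where
    θ-· : ∀ c → θ Γ (c · basis s) ≡ (if c then tabulate (adj Γ s) else 0V)
    θ-· true  = tabulate-cong (B-basis Γ s)
    θ-· false = θ-0

  act-θ : ∀ w x → act Γ w (θ Γ x) ≡ θ Γ (Φ w x)
  act-θ []      x = refl
  act-θ (s ∷ w) x = trans (cong (κ Γ s) (act-θ w x)) (κ-θ s (Φ w x))

  Φ-InO : ∀ w → InO Γ (Φ w)
  Φ-InO w = (additive (Φ-isometry w) , Φ (reverse w) , Φ-reverseˡ w , Φ-reverseʳ w) , q-preserved (Φ-isometry w)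

  act⇔Φ : ∀ w w' → (act Γ w ≗ act Γ w' → Φ w ≗ Φ w') × (Φ w ≗ Φ w' → act Γ w ≗ act Γ w')
  act⇔Φ w w' =
    (λ e x → θ-injective _ _ (trans (sym (act-θ w x)) (trans (e (θ Γ x)) (act-θ w' x)))) ,
    λ e f → let x , θx≡f = θ-surjective f in subst (λ f → act Γ w f ≡ act Γ w' f) θx≡f
      (trans (act-θ w x) (trans (cong (θ Γ) (e x)) (sym (act-θ w' x))))

  Φ-≢0 : ∀ w {x} → x ≢ 0V → Φ w x ≢ 0V
  Φ-≢0 w {x} x≢0 e = x≢0 (trans (sym (Φ-reverseˡ w x))
    (trans (cong (Φ (reverse w)) e) (zero-preserved (Φ-isometry (reverse w)))))

  -- The isomorphism reads a word in the `κ` as the same word in the transvections; the hypothesis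
  -- gives its surjectivity.
  H≅O : (∀ {σ} → Isometry σ → InG σ) → HIsoO Γ
  H≅O isometry-in-G = Φ , Φ-InO , act⇔Φ , Φ-++ , λ σ ((σ-additive , _) , σ-q) →
    isometry-in-G (record { additive = σ-additive ; q-preserved = σ-q })

  module _
    (move-between : ∀ {x y} → x ≢ 0V → y ≢ 0V → Q Γ x ≡ Q Γ y → ∃[ w ] Φ w x ≡ y)
    (q-attained : ∀ c → ∃[ x ] (Q Γ x ≡ c × x ≢ 0V)) where

    orbit-move : ∀ {x y} → x ≢ 0V → y ≢ 0V → Q Γ x ≡ Q Γ y → InOrbit Γ (θ Γ x) (θ Γ y)
    orbit-move {x} {y} x≢0 y≢0 qxy with move-between {x} {y} x≢0 y≢0 qxy
    ... | w , e = w , trans (act-θ w x) (cong (θ Γ) e)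

    orbit-X₀ : OrbitIs Γ (θ Γ 0V) (X₀ Γ)
    orbit-X₀ g =
      (λ (w , e) → trans (sym e) (trans (act-θ w 0V) (trans (cong (θ Γ) (zero-preserved (Φ-isometry w))) θ-0))) ,
      λ g≡0 → [] , trans θ-0 (sym g≡0)

    orbit-X₁ : ∀ {x} → Q Γ x ≡ false → x ≢ 0V → OrbitIs Γ (θ Γ x) (X₁ Γ)
    orbit-X₁ {x} qx x≢0 g =
      (λ (w , e) → Φ w x , trans (q-preserved (Φ-isometry w) x) qx , Φ-≢0 w x≢0 , trans (sym (act-θ w x)) e) ,
      λ { (y , qy , y≢0 , refl) → orbit-move {x} {y} x≢0 y≢0 (trans qx (sym qy)) }

    orbit-X₂ : ∀ {x} → Q Γ x ≡ true → OrbitIs Γ (θ Γ x) (X₂ Γ)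
    orbit-X₂ {x} qx g =
      (λ (w , e) → Φ w x , trans (q-preserved (Φ-isometry w) x) qx , trans (sym (act-θ w x)) e) ,
      λ { (y , qy , refl) → orbit-move {x} {y} (q-true⇒≢0 {x} qx) (q-true⇒≢0 {y} qy) (trans qx (sym qy)) }

    orbits : OrbitsAre Γ
    orbits = classify-orbit ,
      (θ Γ 0V , orbit-X₀) ,
      (let x , qx , x≢0 = q-attained false in θ Γ x , orbit-X₁ {x} qx x≢0) ,
      (let x , qx , _ = q-attained true in θ Γ x , orbit-X₂ {x} qx)
      where
      classify-orbit : ∀ f → OrbitIs Γ f (X₀ Γ) ⊎ OrbitIs Γ f (X₁ Γ) ⊎ OrbitIs Γ f (X₂ Γ)
      classify-orbit f with θ-surjective f
      ... | x , refl with x ≟V 0V | Q Γ x in qx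
      ...   | yes refl | _     = inj₁ orbit-X₀
      ...   | no x≢0   | false = inj₂ (inj₁ (orbit-X₁ {x} qx x≢0))
      ...   | no x≢0   | true  = inj₂ (inj₂ (orbit-X₂ {x} qx))

theorem3p1 : ∀ {n : ℕ} (Γ : Graph n) → Connected Γ → NonDegenerate Γ → ¬ IsLineGraph Γ
    → HIsoO Γ × OrbitsAre Γ
theorem3p1 {zero}  Γ _ _ ¬line = contradiction (no-vertices⇒line-graph Γ) ¬line
theorem3p1 {suc n} Γ connected nondegenerate ¬line = H≅O isometry-in-G , orbits move-between q-attained
  where
  open Configurations Γ nondegenerate
  open LineGraphOrE₆ Γ (B-basis Γ) basis-injective connected
  E₆-roots : E₆-Roots
  E₆-roots = [ (λ line → contradiction line ¬line) , id ]′ (line-graph-or-E₆ zero)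
  open FromE₆ E₆-roots Γ (B-basis Γ) connected basis-induction
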